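{- Let $n\ge 4$. Among all unicyclic graphs on $n$ vertices, the cycle $C_n$ is the unique graph with maximum sum-connectivity index, which equals $\frac n2$. For $n=4$, $U_{4,3}$ (the triangle with one pendant vertex attached) is the unique graph with the second maximum sum-connectivity index, which equals $1+\frac{2}{\sqrt5}$. For $n\ge5$, the $n$-vertex graphs obtained by attaching a path of length at least two to a vertex of a cycle are exactly the graphs with the second maximum sum-connectivity index, which equals $\frac12(n-4)+\frac1{\sqrt3}+\frac{3}{\sqrt5}$.
   Context: A unicyclic graph is a connected simple graph containing exactly one cycle. For a graph $G$ and vertex $v$, $d_v$ denotes the degree of $v$. The sum-connectivity index is $\chi(G)=\sum_{uv\in E(G)}(d_u+d_v)^{ -1/2}$. $C_n$ denotes the cycle on $n$ vertices. Attaching a path of length $r$ to a vertex $u$ means adding a new path on $r$ vertices and an edge between $u$ and one terminal vertex of that path; a path of length at least two thus has at least two vertices. -}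

module Defs where

open import Data.Bool using (Bool; true; false; _∧_; _∨_; if_then_else_)
open import Data.Nat as ℕ using (ℕ; zero; suc; _≡ᵇ_; _<ᵇ_; _∸_; _+_)
open import Data.Nat.ListAction using (sum)
open import Data.Bool using (not)
open import Data.Bool.Properties using (∨-comm; ∧-zeroʳ)
open import Relation.Binary.PropositionalEquality using (cong₂; trans)
open import Data.Fin using (Fin; toℕ)
open import Data.List using (List; []; _∷_; _++_; [_]; length; allFin; map; concatMap)
open import Data.List.Relation.Unary.Unique.Propositional using (Unique)
open import Data.Product using (Σ; _×_; _,_)
open import Data.Sum using (_⊎_)
open import Data.Integer using (+_)
open import Data.Rational using (ℚ; _*_; _-_; _≤_; _<_; 0ℚ; 1ℚ) renaming (_/_ to _//_)
open import Relation.Binary.PropositionalEquality using (_≡_)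
open import Relation.Nullary using (¬_)
open import Function.Bundles using (_↔_; Inverse)

record Graph (n : ℕ) : Set where
  field
    adj    : Fin n → Fin n → Bool
    sym    : ∀ i j → adj i j ≡ adj j i
    irrefl : ∀ i → adj i i ≡ false
open Graph public

deg : ∀ {n} → Graph n → Fin n → ℕ
deg {n} G i = sum (map (λ j → if adj G i j then 1 else 0) (allFin n))

Iso : ∀ {n} → Graph n → Graph n → Set
Iso {n} G H = Σ (Fin n ↔ Fin n) λ f →
  ∀ i j → adj H (Inverse.to f i) (Inverse.to f j) ≡ adj G i j

data Reach {n} (G : Graph n) : Fin n → Fin n → Set where
  here : ∀ {u} → Reach G u u
  step : ∀ {u w v} → adj G u w ≡ true → Reach G w v → Reach G u v

Connected : ∀ {n} → Graph n → Set
Connected {n} G = ∀ (u v : Fin n) → Reach G u v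

-- Cycles: a cycle is given by a list of distinct vertices v0 … v(k-1),
-- k ≥ 3, with v(i) ~ v(i+1) and v(k-1) ~ v0.  Two such lists describe
-- the same cycle (subgraph) iff they have the same edge set.

Chain : ∀ {n} → Graph n → List (Fin n) → Set
Chain G []           = Data.Unit.⊤ where import Data.Unit
Chain G (x ∷ [])     = Data.Unit.⊤ where import Data.Unit
Chain G (x ∷ y ∷ r)  = (adj G x y ≡ true) × Chain G (y ∷ r)

InChain : ∀ {n} → List (Fin n) → Fin n → Fin n → Set
InChain []          u v = Data.Empty.⊥ where import Data.Empty
InChain (x ∷ [])    u v = Data.Empty.⊥ where import Data.Empty
InChain (x ∷ y ∷ r) u v = ((u ≡ x) × (v ≡ y)) ⊎ ((u ≡ y) × (v ≡ x)) ⊎ InChain (y ∷ r) u v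

IsCycle : ∀ {n} → Graph n → List (Fin n) → Set
IsCycle G []       = Data.Empty.⊥ where import Data.Empty
IsCycle G (x ∷ xs) = (3 ℕ.≤ length (x ∷ xs)) × Unique (x ∷ xs) × Chain G (x ∷ xs ++ [ x ])

CycleEdge : ∀ {n} → List (Fin n) → Fin n → Fin n → Set
CycleEdge []       u v = Data.Empty.⊥ where import Data.Empty
CycleEdge (x ∷ xs) u v = InChain (x ∷ xs ++ [ x ]) u v

SameCycle : ∀ {n} → List (Fin n) → List (Fin n) → Set
SameCycle {n} c d = ∀ (u v : Fin n) → (CycleEdge c u v → CycleEdge d u v) × (CycleEdge d u v → CycleEdge c u v)

Unicyclic : ∀ {n} → Graph n → Set
Unicyclic {n} G = Connected G × Σ (List (Fin n)) λ c → IsCycle G c × (∀ d → IsCycle G d → SameCycle c d)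

-- Exact real numbers of the form  Σ c_i / √k_i  (c_i, k_i ∈ ℕ),
-- represented as lists of pairs (c , k), compared exactly via rational
-- upper/lower bounds of 1/√k.

SqExpr : Set
SqExpr = List (ℕ × ℕ)

ℕtoℚ : ℕ → ℚ
ℕtoℚ m = (+ m) // 1

IsUpper : ℕ → ℚ → Set
IsUpper k q = (0ℚ ≤ q) × (1ℚ ≤ q * q * ℕtoℚ k)

IsLower : ℕ → ℚ → Set
IsLower k q = (0ℚ ≤ q) × (q * q * ℕtoℚ k ≤ 1ℚ)

Below : SqExpr → ℚ → Set
Below []            q = 0ℚ < q
Below ((c , k) ∷ e) q = Σ ℚ λ u → IsUpper k u × Below e (q - ℕtoℚ c * u)

Above : SqExpr → ℚ → Set
Above []            q = q < 0ℚ
Above ((c , k) ∷ e) q = Σ ℚ λ l → IsLower k l × Above e (q - ℕtoℚ c * l)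

_<ᵣ_ : SqExpr → SqExpr → Set
x <ᵣ y = Σ ℚ λ q → Below x q × Above y q

_≈ᵣ_ : SqExpr → SqExpr → Set
x ≈ᵣ y = ¬ (x <ᵣ y) × ¬ (y <ᵣ x)

infix 4 _<ᵣ_ _≈ᵣ_

χ : ∀ {n} → Graph n → SqExpr
χ {n} G = concatMap (λ i → concatMap (λ j →
            if (toℕ i <ᵇ toℕ j) ∧ adj G i j then [ (1 , deg G i + deg G j) ] else [])
          (allFin n)) (allFin n)

-- Concrete graphs.  lollipop n k (k ≥ 3, k ≤ n): cycle on vertices
-- 0,…,k-1 (edges i(i+1) and 0(k-1)), plus the path k, k+1, …, n-1
-- attached to vertex 0 by the edge 0k (if k < n).

lolE : ℕ → ℕ → ℕ → Bool
lolE k i j = ((j ≡ᵇ suc i) ∧ ((j <ᵇ k) ∨ ((i ≡ᵇ k) ∨ (k <ᵇ i))))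
           ∨ ((i ≡ᵇ 0) ∧ (j ≡ᵇ (k ∸ 1)))
           ∨ ((i ≡ᵇ 0) ∧ (j ≡ᵇ k))

mkGraph : (n : ℕ) → (ℕ → ℕ → Bool) → Graph n
mkGraph n e = record
  { adj    = λ i j → (e (toℕ i) (toℕ j) ∨ e (toℕ j) (toℕ i)) ∧ not (toℕ i ≡ᵇ toℕ j)
  ; sym    = λ i j → cong₂ (λ a b → a ∧ not b) (∨-comm (e (toℕ i) (toℕ j)) _) (≡ᵇ-sym (toℕ i) (toℕ j))
  ; irrefl = λ i → trans (cong₂ (λ a b → a ∧ not b) {x = e (toℕ i) (toℕ i) ∨ e (toℕ i) (toℕ i)} refl (≡ᵇ-refl (toℕ i))) (∧-zeroʳ _)
  }
  where
  open Relation.Binary.PropositionalEquality using (refl)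
  ≡ᵇ-refl : ∀ m → (m ≡ᵇ m) ≡ true
  ≡ᵇ-refl zero    = refl
  ≡ᵇ-refl (suc m) = ≡ᵇ-refl m
  ≡ᵇ-sym : ∀ a b → (a ≡ᵇ b) ≡ (b ≡ᵇ a)
  ≡ᵇ-sym zero    zero    = refl
  ≡ᵇ-sym zero    (suc b) = refl
  ≡ᵇ-sym (suc a) zero    = refl
  ≡ᵇ-sym (suc a) (suc b) = ≡ᵇ-sym a b

lollipop : (n k : ℕ) → Graph n
lollipop n k = mkGraph n (lolE k)

Cyc : (n : ℕ) → Graph n
Cyc n = lollipop n n

U43 : Graph 4
U43 = lollipop 4 3

CycleWithPath : ∀ {n} → Graph n → Set
CycleWithPath {n} G = Σ ℕ λ k → (3 ℕ.≤ k) × (k + 2 ℕ.≤ n) × Iso G (lollipop n k)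

{-# OPTIONS --safe #-}
module Submission where

-- Write f(a,b) = 1/√(a+b).  A unicyclic graph has n edges, and the edge sum of
-- 1/d_u + 1/d_v is n.  With β = 2/√3 - 1 the slack
--   g(a,b) = 1/2 + β (1/a + 1/b - 1) - f(a,b)
-- is nonnegative on all possible edges (the degrees 1, 1 are excluded) and vanishes
-- at (1,2) and (2,2), so χ(G) = n/2 - Σ g.  If some degree exceeds 2, the three
-- edges at a single vertex of degree 3 have total slack at least 3 g(2,3), which is
-- the slack of a cycle with an attached path of length at least two; a second branch
-- vertex, a vertex of degree at least 4, or a leaf next to the branch vertex forces
-- strictly more.  The degrees then determine the graph: a walk from the leaf that
-- never turns back visits every vertex and closes up at the branch vertex.

open import Defs hiding (sym)
open import Level using (0ℓ)
open import Algebra.Bundles using (CommutativeMonoid)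
open import Data.Bool using (Bool; true; false; T; _∧_; _∨_; not; if_then_else_)
open import Data.Bool.Properties using (∧-zeroʳ; ∨-comm; ⇔→≡; T-∧; T-∨; T-≡) renaming (_≟_ to _≟ᵇ_)
open import Data.Nat as ℕ using (ℕ; zero; suc; _<ᵇ_)
import Data.Nat.Properties as ℕ
open import Data.Nat.ListAction using () renaming (sum to sumL)
open import Data.Fin as F using (Fin; zero; suc; toℕ; punchIn)
import Data.Fin.Properties as F
open import Data.List as L using (List; []; _∷_; [_]; _++_; length; map; allFin; concatMap; applyUpTo)
open import Data.List.Properties using (map-id; map-++; map-tabulate; length-map; length-applyUpTo)
open import Data.Product using (_,_)
open import Function using (_∘_; id)
open import Relation.Binary using (tri<; tri≈; tri>)
open import Relation.Binary.PropositionalEquality as ≡ using (_≡_)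
open import Relation.Nullary using (does; yes; no)
open import Relation.Nullary.Decidable using (dec-true; dec-false; does-⇔; from-yes; _→-dec_; _×-dec_; ¬?)

-- Real numbers are present only through rational bounds on 1/√k, which separates two kinds of
-- claim. A strict inequality is reduced to one between natural numbers by rounding every bound to a
-- multiple of 1/12000. In this unit 1/√4 is exact, so the value n/2 and the term (n - 4)/2 carry no
-- rounding error however large n is. An equality is proved as an identity that holds for every
-- assignment of rationals to the symbols 1/√k. Rounded estimates can never show that two graphs
-- tie. Hence the dichotomy of the proof: a unicyclic graph either loses a definite number of units
-- against n/2, or its degree sequence is already that of a cycle with at most one path attached. In
-- the second case the graph is reconstructed and its value computed or bounded separately. Having
-- only one cycle yields that the degree sum is at most 2n. A smaller degree sum is absorbed as a
-- loss of 2070 units for every unit missing.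

-- Sums over the edges of a graph

<ᵇ-true : ∀ {a b} → a ℕ.< b → (a <ᵇ b) ≡ true
<ᵇ-true {a} {b} = dec-true (a ℕ.<? b)

<ᵇ-false : ∀ {a b} → b ℕ.≤ a → (a <ᵇ b) ≡ false
<ᵇ-false {a} {b} b≤a = dec-false (a ℕ.<? b) (ℕ.≤⇒≯ b≤a)

-- The monoid is left open so that the same identities serve the bounds in natural numbers and the
-- exact values in rationals. In `eval`, `u k` takes the place of 1/√k.
module Sums (M : CommutativeMonoid 0ℓ 0ℓ) where
  open CommutativeMonoid M renaming
    ( _∙_ to infixl 6 _+_ ; ∙-cong to +-cong ; ∙-congˡ to +-congˡ ; ∙-congʳ to +-congʳ
    ; identityˡ to +-identityˡ ; identityʳ to +-identityʳ
    ; assoc to +-assoc ; comm to +-comm ; ε to 0# )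
  open import Algebra.Properties.CommutativeMonoid.Sum M public
    using (sum; sum-syntax; sum-cong-≋; sum-replicate; sum-replicate-zero; sum-remove; ∑-distrib-+; ∑-comm)
  open import Algebra.Properties.CommutativeMonoid.Mult M public using (_×_; ×-homo-1)
  open import Relation.Binary.Reasoning.Setoid setoid

  eval : (ℕ → Carrier) → SqExpr → Carrier
  eval u []            = 0#
  eval u ((c , k) ∷ e) = c × u k + eval u e

  pick : Bool → Carrier → Carrier
  pick b x = if b then x else 0#

  pick-cong : ∀ b {x y} → x ≈ y → pick b x ≈ pick b y
  pick-cong true  e = e
  pick-cong false e = refl

  pick-+ : ∀ b x y → pick b (x + y) ≈ pick b x + pick b y
  pick-+ true  x y = refl
  pick-+ false x y = sym (+-identityˡ 0#)

  eval-++ : ∀ u e f → eval u (e ++ f) ≈ eval u e + eval u f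
  eval-++ u []            f = sym (+-identityˡ _)
  eval-++ u ((c , k) ∷ e) f = trans (+-congˡ (eval-++ u e f)) (sym (+-assoc _ _ _))

  eval-concatMap : ∀ u {n} {A : Set} (g : Fin n → A) (f : A → SqExpr) →
    eval u (concatMap f (L.tabulate g)) ≈ ∑[ i < n ] eval u (f (g i))
  eval-concatMap u {zero}  g f = refl
  eval-concatMap u {suc n} g f =
    trans (eval-++ u (f (g zero)) _) (+-congˡ (eval-concatMap u (g ∘ suc) f))

  eval-χ : ∀ u {n} (G : Graph n) → eval u (χ G) ≈
    ∑[ i < n ] ∑[ j < n ] pick ((toℕ i <ᵇ toℕ j) ∧ adj G i j) (u (deg G i ℕ.+ deg G j))
  eval-χ u {n} G = trans (eval-concatMap u {n} id _) (sum-cong-≋ {n} λ i →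
    trans (eval-concatMap u {n} id _) (sum-cong-≋ {n} λ j → entry ((toℕ i <ᵇ toℕ j) ∧ adj G i j) _))
    where
    entry : ∀ b k → eval u (if b then [ (1 , k) ] else []) ≈ pick b (u k)
    entry true  k = trans (+-identityʳ _) (×-homo-1 _)
    entry false k = refl

  ∑-pick-const : ∀ x {n} (b : Fin n → Bool) →
    ∑[ i < n ] pick (b i) x ≈ sumL (map (λ i → if b i then 1 else 0) (allFin n)) × x
  ∑-pick-const x {n} b = ≡.subst (λ l → ∑[ i < n ] pick (b i) x ≈ sumL l × x) (≡.sym (map-tabulate {n = n} id (λ i → if b i then 1 else 0))) (go n b)
    where
    go : ∀ n (b : Fin n → Bool) →
      ∑[ i < n ] pick (b i) x ≈ sumL (L.tabulate (λ i → if b i then 1 else 0)) × x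
    go zero    b = refl
    go (suc n) b with b zero
    ... | true  = +-congˡ (go n (b ∘ suc))
    ... | false = trans (+-identityˡ _) (go n (b ∘ suc))

  ∑-adj-const : ∀ {n} (G : Graph n) i x → ∑[ j < n ] pick (adj G i j) x ≈ deg G i × x
  ∑-adj-const G i x = ∑-pick-const x (adj G i)

  -- Exchanging the two sums turns the terms `K j i` with i < j into terms `K i j` with j < i. The
  -- two triangles and the empty diagonal make up all ordered pairs.
  handshake : ∀ {n} (G : Graph n) (K : Fin n → Fin n → Carrier) →
    ∑[ i < n ] ∑[ j < n ] pick ((toℕ i <ᵇ toℕ j) ∧ adj G i j) (K i j + K j i)
      ≈ ∑[ i < n ] ∑[ j < n ] pick (adj G i j) (K i j)
  handshake {n} G K = begin
    ∑[ i < n ] ∑[ j < n ] pick (b i j) (K i j + K j i)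
      ≈⟨ sum-cong-≋ {n} (λ i → trans (sum-cong-≋ {n} λ j → pick-+ (b i j) _ _) (∑-distrib-+ {n} _ _)) ⟩
    ∑[ i < n ] (∑[ j < n ] pick (b i j) (K i j) + ∑[ j < n ] pick (b i j) (K j i))
      ≈⟨ ∑-distrib-+ {n} _ _ ⟩
    ∑[ i < n ] ∑[ j < n ] pick (b i j) (K i j) + ∑[ i < n ] ∑[ j < n ] pick (b i j) (K j i)
      ≈⟨ +-congˡ (∑-comm {n} {n} (λ i j → pick (b i j) (K j i))) ⟩
    ∑[ i < n ] ∑[ j < n ] pick (b i j) (K i j) + ∑[ i < n ] ∑[ j < n ] pick (b j i) (K i j)
      ≈⟨ ∑-distrib-+ {n} _ _ ⟨
    ∑[ i < n ] (∑[ j < n ] pick (b i j) (K i j) + ∑[ j < n ] pick (b j i) (K i j))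
      ≈⟨ sum-cong-≋ {n} (λ i → trans (sum-cong-≋ {n} λ j → split i j (K i j)) (∑-distrib-+ {n} _ _)) ⟨
    ∑[ i < n ] ∑[ j < n ] pick (adj G i j) (K i j) ∎
    where
    b : Fin n → Fin n → Bool
    b i j = (toℕ i <ᵇ toℕ j) ∧ adj G i j
    split : ∀ i j x → pick (adj G i j) x ≈ pick (b i j) x + pick (b j i) x
    split i j x with ℕ.<-cmp (toℕ i) (toℕ j)
    ... | tri< i<j _ _
      rewrite <ᵇ-true i<j | <ᵇ-false (ℕ.<⇒≤ i<j) = sym (+-identityʳ _)
    ... | tri> _ _ j<i
      rewrite <ᵇ-true j<i | <ᵇ-false (ℕ.<⇒≤ j<i) | Graph.sym G i j = sym (+-identityˡ _)
    ... | tri≈ _ e _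
      rewrite F.toℕ-injective e | Graph.irrefl G j | <ᵇ-false (ℕ.≤-refl {toℕ j}) = sym (+-identityˡ _)

  ∑-pick-≟ : ∀ {n} (v : Fin n) x → ∑[ i < n ] pick (does (i F.≟ v)) x ≈ x
  ∑-pick-≟ {suc n} zero    x = trans (+-congˡ (sum-replicate-zero n)) (+-identityʳ x)
  ∑-pick-≟ {suc n} (suc v) x = trans (+-identityˡ _) (∑-pick-≟ v x)

  -- Once the value of each edge is a sum of shares of its two ends, the index can be collected
  -- vertex by vertex. All exact evaluations go this way.
  ∑-charges : ∀ {n} (G : Graph n) (u : ℕ → Carrier) (s : Fin n → Carrier) →
    (∀ i j → adj G i j ≡ true → u (deg G i ℕ.+ deg G j) ≈ s i + s j) →
    eval u (χ G) ≈ ∑[ i < n ] (deg G i × s i)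
  ∑-charges {n} G u s edge = begin
    eval u (χ G) ≈⟨ eval-χ u G ⟩
    ∑[ i < n ] ∑[ j < n ] pick ((toℕ i <ᵇ toℕ j) ∧ adj G i j) (u (deg G i ℕ.+ deg G j))
      ≈⟨ sum-cong-≋ {n} (λ i → sum-cong-≋ {n} λ j → conv i j) ⟩
    ∑[ i < n ] ∑[ j < n ] pick ((toℕ i <ᵇ toℕ j) ∧ adj G i j) (s i + s j)
      ≈⟨ handshake G (λ i _ → s i) ⟩
    ∑[ i < n ] ∑[ j < n ] pick (adj G i j) (s i)
      ≈⟨ sum-cong-≋ {n} (λ i → ∑-adj-const G i (s i)) ⟩
    ∑[ i < n ] (deg G i × s i) ∎
    where
    conv : ∀ i j → pick ((toℕ i <ᵇ toℕ j) ∧ adj G i j) (u (deg G i ℕ.+ deg G j))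
                 ≈ pick ((toℕ i <ᵇ toℕ j) ∧ adj G i j) (s i + s j)
    conv i j with adj G i j | edge i j
    ... | true  | e = pick-cong ((toℕ i <ᵇ toℕ j) ∧ true) (e ≡.refl)
    ... | false | _ rewrite ∧-zeroʳ (toℕ i <ᵇ toℕ j) = refl

  -- The half `s` of `u 4` is an argument because a commutative monoid has no halving.
  eval-2-regular : ∀ {n} (G : Graph n) (u : ℕ → Carrier) s → s + s ≈ u 4 → (∀ i → deg G i ≡ 2) →
    eval u (χ G) ≈ n × u 4
  eval-2-regular {n} G u s s+s 2-reg = begin
    eval u (χ G)               ≈⟨ ∑-charges G u (λ _ → s) edge ⟩
    ∑[ i < n ] (deg G i × s)   ≈⟨ sum-cong-≋ {n} (λ i → trans (reflexive (≡.cong (_× s) (2-reg i))) (trans (+-congˡ (+-identityʳ s)) s+s)) ⟩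
    ∑[ i < n ] u 4             ≈⟨ sum-replicate n ⟩
    n × u 4                    ∎
    where
    edge : ∀ i j → adj G i j ≡ true → u (deg G i ℕ.+ deg G j) ≈ s + s
    edge i j _ rewrite 2-reg i | 2-reg j = sym s+s

open import Algebra.Properties.Semiring.Sum ℕ.+-*-semiring using (*-distribˡ-sum)
open import Data.Empty using (⊥; ⊥-elim)
import Data.Integer as ℤ
import Data.Integer.Properties as ℤ
open import Data.List.Membership.DecPropositional using () renaming (_∈?_ to ∈?)
open import Data.List.Membership.Propositional using (_∈_)
open import Data.List.Membership.Propositional.Properties using (∈-map⁺; ∈-map⁻)
open import Data.List.Relation.Unary.All as All using (All; []; _∷_)
open import Data.List.Relation.Unary.All.Properties using (¬Any⇒All¬; concat⁺; map⁺; tabulate⁺)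
open import Data.List.Relation.Unary.AllPairs using ([]; _∷_)
open import Data.List.Relation.Unary.Any using (here; there)
open import Data.List.Relation.Unary.Unique.Propositional using (Unique)
import Data.List.Relation.Unary.Unique.Propositional.Properties as Unique
open import Data.Nat using (_+_; _*_; _∸_; _≤_; _<_; z≤n; s≤s)
open import Data.Nat.Solver renaming (module +-*-Solver to ℕ-Solver)
open import Data.Product using (Σ; ∃; ∃₂; _×_; proj₁; proj₂)
open import Data.Rational as ℚ using (ℚ; 0ℚ; 1ℚ; ½; -_; toℚᵘ)
  renaming (_+_ to _⊕_; _*_ to _⊗_; _-_ to _⊖_; _≤_ to _ℚ≤_; _<_ to _ℚ<_)
import Data.Rational.Properties as ℚ
open import Data.Rational.Solver renaming (module +-*-Solver to ℚ-Solver)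
open import Data.Rational.Unnormalised as ℚᵘ using (mkℚᵘ; *≡*; *≤*; *<*)
import Data.Rational.Unnormalised.Properties as ℚᵘ
open import Data.Sum using (_⊎_; inj₁; inj₂; swap)
open import Function.Bundles using (mk↔ₛ′; mk⇔; Inverse; Equivalence)
open import Relation.Binary.PropositionalEquality hiding ([_])
open import Relation.Nullary using (¬_; Dec)

-- Comparing the formal sums of multiples of 1/√k

module SN = Sums ℕ.+-0-commutativeMonoid
module SQ = Sums ℚ.+-0-commutativeMonoid

ℕtoℚᵘ : ℕ → ℚᵘ.ℚᵘ
ℕtoℚᵘ m = mkℚᵘ (ℤ.+ m) 0

ℕtoℚ-homo-+ : ∀ m n → ℕtoℚ (m ℕ.+ n) ≡ ℕtoℚ m ⊕ ℕtoℚ n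
ℕtoℚ-homo-+ m n = ℚ.toℚᵘ-injective (begin-equality
  toℚᵘ (ℕtoℚ (m ℕ.+ n))              ≃⟨ ℚ.toℚᵘ-fromℚᵘ (ℕtoℚᵘ (m ℕ.+ n)) ⟩
  ℕtoℚᵘ (m ℕ.+ n)                    ≃⟨ *≡* (cong (ℤ._* ℤ.1ℤ) (trans (ℤ.pos-+ m n)
                                          (sym (cong₂ ℤ._+_ (ℤ.*-identityʳ (ℤ.+ m)) (ℤ.*-identityʳ (ℤ.+ n)))))) ⟩
  ℕtoℚᵘ m ℚᵘ.+ ℕtoℚᵘ n                ≃⟨ ℚᵘ.+-cong (ℚ.toℚᵘ-fromℚᵘ (ℕtoℚᵘ m)) (ℚ.toℚᵘ-fromℚᵘ (ℕtoℚᵘ n)) ⟨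
  toℚᵘ (ℕtoℚ m) ℚᵘ.+ toℚᵘ (ℕtoℚ n)    ≃⟨ ℚ.toℚᵘ-homo-+ (ℕtoℚ m) (ℕtoℚ n) ⟨
  toℚᵘ (ℕtoℚ m ⊕ ℕtoℚ n)             ∎)
  where open ℚᵘ.≤-Reasoning

ℕtoℚ-homo-* : ∀ m n → ℕtoℚ (m ℕ.* n) ≡ ℕtoℚ m ⊗ ℕtoℚ n
ℕtoℚ-homo-* zero    n = sym (ℚ.*-zeroˡ (ℕtoℚ n))
ℕtoℚ-homo-* (suc m) n = begin
  ℕtoℚ (n ℕ.+ m ℕ.* n)             ≡⟨ ℕtoℚ-homo-+ n (m ℕ.* n) ⟩
  ℕtoℚ n ⊕ ℕtoℚ (m ℕ.* n)         ≡⟨ cong₂ _⊕_ (sym (ℚ.*-identityˡ (ℕtoℚ n))) (ℕtoℚ-homo-* m n) ⟩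
  1ℚ ⊗ ℕtoℚ n ⊕ ℕtoℚ m ⊗ ℕtoℚ n   ≡⟨ ℚ.*-distribʳ-+ (ℕtoℚ n) 1ℚ (ℕtoℚ m) ⟨
  (1ℚ ⊕ ℕtoℚ m) ⊗ ℕtoℚ n          ≡⟨ cong (_⊗ ℕtoℚ n) (ℕtoℚ-homo-+ 1 m) ⟨
  ℕtoℚ (suc m) ⊗ ℕtoℚ n            ∎
  where open ≡-Reasoning

ℕtoℚ-mono-≤ : ∀ {m n} → m ℕ.≤ n → ℕtoℚ m ℚ≤ ℕtoℚ n
ℕtoℚ-mono-≤ {m} {n} m≤n = ℚ.toℚᵘ-cancel-≤ (begin
  toℚᵘ (ℕtoℚ m) ≃⟨ ℚ.toℚᵘ-fromℚᵘ (ℕtoℚᵘ m) ⟩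
  ℕtoℚᵘ m       ≤⟨ *≤* (ℤ.*-monoʳ-≤-nonNeg ℤ.1ℤ (ℤ.+≤+ m≤n)) ⟩
  ℕtoℚᵘ n       ≃⟨ ℚ.toℚᵘ-fromℚᵘ (ℕtoℚᵘ n) ⟨
  toℚᵘ (ℕtoℚ n) ∎)
  where open ℚᵘ.≤-Reasoning

ℕtoℚ-mono-< : ∀ {m n} → m ℕ.< n → ℕtoℚ m ℚ< ℕtoℚ n
ℕtoℚ-mono-< {m} {n} m<n = ℚ.toℚᵘ-cancel-< (begin-strict
  toℚᵘ (ℕtoℚ m) ≃⟨ ℚ.toℚᵘ-fromℚᵘ (ℕtoℚᵘ m) ⟩
  ℕtoℚᵘ m       <⟨ *<* (ℤ.*-monoʳ-<-pos ℤ.1ℤ (ℤ.+<+ m<n)) ⟩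
  ℕtoℚᵘ n       ≃⟨ ℚ.toℚᵘ-fromℚᵘ (ℕtoℚᵘ n) ⟨
  toℚᵘ (ℕtoℚ n) ∎)
  where open ℚᵘ.≤-Reasoning

0≤ℕtoℚ : ∀ n → 0ℚ ℚ≤ ℕtoℚ n
0≤ℕtoℚ n = ℕtoℚ-mono-≤ {0} {n} ℕ.z≤n

*-nonNeg : ∀ {p q} → 0ℚ ℚ≤ p → 0ℚ ℚ≤ q → 0ℚ ℚ≤ p ⊗ q
*-nonNeg {p} {q} 0≤p 0≤q = ℚ.≤-trans (ℚ.≤-reflexive (sym (ℚ.*-zeroʳ p)))
  (ℚ.*-monoˡ-≤-nonNeg p {{ℚ.nonNegative 0≤p}} 0≤q)

evalℚ : (ℕ → ℚ) → SqExpr → ℚ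
evalℚ u []            = 0ℚ
evalℚ u ((c , k) ∷ e) = ℕtoℚ c ⊗ u k ⊕ evalℚ u e

×≡ℕtoℚ* : ∀ c x → c SQ.× x ≡ ℕtoℚ c ⊗ x
×≡ℕtoℚ* zero    x = sym (ℚ.*-zeroˡ x)
×≡ℕtoℚ* (suc c) x = begin
  x ⊕ c SQ.× x              ≡⟨ cong₂ _⊕_ (sym (ℚ.*-identityˡ x)) (×≡ℕtoℚ* c x) ⟩
  1ℚ ⊗ x ⊕ ℕtoℚ c ⊗ x       ≡⟨ ℚ.*-distribʳ-+ x 1ℚ (ℕtoℚ c) ⟨
  (1ℚ ⊕ ℕtoℚ c) ⊗ x         ≡⟨ cong (_⊗ x) (ℕtoℚ-homo-+ 1 c) ⟨
  ℕtoℚ (suc c) ⊗ x           ∎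
  where open ≡-Reasoning

×≡* : ∀ c x → c SN.× x ≡ c ℕ.* x
×≡* zero    x = refl
×≡* (suc c) x = cong (x ℕ.+_) (×≡* c x)

eval≡evalℚ : ∀ u e → SQ.eval u e ≡ evalℚ u e
eval≡evalℚ u []            = refl
eval≡evalℚ u ((c , k) ∷ e) = cong₂ _⊕_ (×≡ℕtoℚ* c (u k)) (eval≡evalℚ u e)

evalℚ-mono : ∀ {u v} → (∀ k → u k ℚ≤ v k) → ∀ e → evalℚ u e ℚ≤ evalℚ v e
evalℚ-mono u≤v []            = ℚ.≤-refl
evalℚ-mono u≤v ((c , k) ∷ e) = ℚ.+-mono-≤
  (ℚ.*-monoˡ-≤-nonNeg (ℕtoℚ c) {{ℚ.nonNegative (0≤ℕtoℚ c)}} (u≤v k)) (evalℚ-mono u≤v e)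

evalℚ-scale : ∀ r (m : ℕ → ℕ) e → evalℚ (λ k → ℕtoℚ (m k) ⊗ r) e ≡ ℕtoℚ (SN.eval m e) ⊗ r
evalℚ-scale r m []            = sym (ℚ.*-zeroˡ r)
evalℚ-scale r m ((c , k) ∷ e) = begin
  ℕtoℚ c ⊗ (ℕtoℚ (m k) ⊗ r) ⊕ evalℚ (λ k → ℕtoℚ (m k) ⊗ r) e
    ≡⟨ cong₂ _⊕_ (sym (ℚ.*-assoc (ℕtoℚ c) (ℕtoℚ (m k)) r)) (evalℚ-scale r m e) ⟩
  ℕtoℚ c ⊗ ℕtoℚ (m k) ⊗ r ⊕ ℕtoℚ (SN.eval m e) ⊗ r
    ≡⟨ ℚ.*-distribʳ-+ r (ℕtoℚ c ⊗ ℕtoℚ (m k)) (ℕtoℚ (SN.eval m e)) ⟨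
  (ℕtoℚ c ⊗ ℕtoℚ (m k) ⊕ ℕtoℚ (SN.eval m e)) ⊗ r
    ≡⟨ cong (λ z → (z ⊕ ℕtoℚ (SN.eval m e)) ⊗ r) (trans (cong ℕtoℚ (×≡* c (m k))) (ℕtoℚ-homo-* c (m k))) ⟨
  (ℕtoℚ (c SN.× m k) ⊕ ℕtoℚ (SN.eval m e)) ⊗ r
    ≡⟨ cong (_⊗ r) (ℕtoℚ-homo-+ (c SN.× m k) (SN.eval m e)) ⟨
  ℕtoℚ (SN.eval m ((c , k) ∷ e)) ⊗ r ∎
  where open ≡-Reasoning

x+y-x≡y : ∀ x y → x ⊕ y ⊖ x ≡ y
x+y-x≡y = solve 2 (λ x y → x :+ y :+ (:- x) := y) refl
  where open ℚ-Solver

y-x+x≡y : ∀ x y → x ⊕ (y ⊖ x) ≡ y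
y-x+x≡y = solve 2 (λ x y → x :+ (y :+ (:- x)) := y) refl
  where open ℚ-Solver

Below-intro : ∀ (u : ℕ → ℚ) {e q} → All (λ ck → IsUpper (proj₂ ck) (u (proj₂ ck))) e →
  evalℚ u e ℚ< q → Below e q
Below-intro u [] lt = lt
Below-intro u {(c , k) ∷ e} {q} (up ∷ ups) lt = u k , up , Below-intro u ups
  (subst (ℚ._< q ⊖ ℕtoℚ c ⊗ u k) (x+y-x≡y (ℕtoℚ c ⊗ u k) (evalℚ u e)) (ℚ.+-monoˡ-< (- (ℕtoℚ c ⊗ u k)) lt))

Above-intro : ∀ (l : ℕ → ℚ) {e q} → All (λ ck → IsLower (proj₂ ck) (l (proj₂ ck))) e →
  q ℚ< evalℚ l e → Above e q
Above-intro l [] lt = lt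
Above-intro l {(c , k) ∷ e} {q} (lo ∷ los) lt = l k , lo , Above-intro l los
  (subst (q ⊖ ℕtoℚ c ⊗ l k ℚ.<_) (x+y-x≡y (ℕtoℚ c ⊗ l k) (evalℚ l e)) (ℚ.+-monoˡ-< (- (ℕtoℚ c ⊗ l k)) lt))

module _ (N : ℕ) .{{_ : ℕ.NonZero N}} where
  private
    open ℚ-Solver

    N⁻¹ : ℚ
    N⁻¹ = (ℤ.+ 1) ℚ./ N

    N*N⁻¹≡1 : ℕtoℚ N ⊗ N⁻¹ ≡ 1ℚ
    N*N⁻¹≡1 = help N
      where
      help : ∀ n .{{_ : ℕ.NonZero n}} → ℕtoℚ n ⊗ ((ℤ.+ 1) ℚ./ n) ≡ 1ℚ
      help (suc n) = ℚ.toℚᵘ-injective (begin-equality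
        toℚᵘ (ℕtoℚ (suc n) ⊗ ((ℤ.+ 1) ℚ./ suc n))
          ≃⟨ ℚ.toℚᵘ-homo-* (ℕtoℚ (suc n)) ((ℤ.+ 1) ℚ./ suc n) ⟩
        toℚᵘ (ℕtoℚ (suc n)) ℚᵘ.* toℚᵘ ((ℤ.+ 1) ℚ./ suc n)
          ≃⟨ ℚᵘ.*-cong (ℚ.toℚᵘ-fromℚᵘ (ℕtoℚᵘ (suc n))) (ℚ.toℚᵘ-fromℚᵘ (mkℚᵘ (ℤ.+ 1) n)) ⟩
        ℕtoℚᵘ (suc n) ℚᵘ.* mkℚᵘ (ℤ.+ 1) n
          ≃⟨ *≡* (cong ℤ.+_ (trans (ℕ.*-identityʳ _) (trans (ℕ.*-identityʳ _) (sym (trans (ℕ.*-identityˡ _) (ℕ.*-identityˡ _)))))) ⟩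
        toℚᵘ 1ℚ ∎)
        where open ℚᵘ.≤-Reasoning

    0<N⁻¹ : 0ℚ ℚ< N⁻¹
    0<N⁻¹ = ℚ.positive⁻¹ N⁻¹ {{ℚ.normalize-pos 1 N}}

    0≤N⁻¹ : 0ℚ ℚ≤ N⁻¹
    0≤N⁻¹ = ℚ.<⇒≤ 0<N⁻¹

    square : ∀ m k → (ℕtoℚ m ⊗ N⁻¹) ⊗ (ℕtoℚ m ⊗ N⁻¹) ⊗ ℕtoℚ k ≡ ℕtoℚ (m ℕ.* m ℕ.* k) ⊗ (N⁻¹ ⊗ N⁻¹)
    square m k = trans
      (solve 3 (λ m r k → (m :* r) :* (m :* r) :* k := m :* m :* k :* (r :* r)) refl (ℕtoℚ m) N⁻¹ (ℕtoℚ k))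
      (cong (_⊗ (N⁻¹ ⊗ N⁻¹)) (sym (trans (ℕtoℚ-homo-* (m ℕ.* m) k) (cong (_⊗ ℕtoℚ k) (ℕtoℚ-homo-* m m)))))

    one : 1ℚ ≡ ℕtoℚ (N ℕ.* N) ⊗ (N⁻¹ ⊗ N⁻¹)
    one = begin
      1ℚ ⊗ 1ℚ                            ≡⟨ cong₂ _⊗_ N*N⁻¹≡1 N*N⁻¹≡1 ⟨
      (ℕtoℚ N ⊗ N⁻¹) ⊗ (ℕtoℚ N ⊗ N⁻¹)    ≡⟨ solve 2 (λ n r → (n :* r) :* (n :* r) := n :* n :* (r :* r)) refl (ℕtoℚ N) N⁻¹ ⟩
      ℕtoℚ N ⊗ ℕtoℚ N ⊗ (N⁻¹ ⊗ N⁻¹)      ≡⟨ cong (_⊗ (N⁻¹ ⊗ N⁻¹)) (ℕtoℚ-homo-* N N) ⟨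
      ℕtoℚ (N ℕ.* N) ⊗ (N⁻¹ ⊗ N⁻¹)       ∎
      where open ≡-Reasoning

    scale-mono : ∀ {a b} → a ℕ.≤ b → ℕtoℚ a ⊗ (N⁻¹ ⊗ N⁻¹) ℚ≤ ℕtoℚ b ⊗ (N⁻¹ ⊗ N⁻¹)
    scale-mono a≤b = ℚ.*-monoʳ-≤-nonNeg (N⁻¹ ⊗ N⁻¹) {{ℚ.nonNegative (*-nonNeg 0≤N⁻¹ 0≤N⁻¹)}} (ℕtoℚ-mono-≤ a≤b)

    isUpper : ∀ m k → N ℕ.* N ℕ.≤ m ℕ.* m ℕ.* k → IsUpper k (ℕtoℚ m ⊗ N⁻¹)
    isUpper m k le = *-nonNeg (0≤ℕtoℚ m) 0≤N⁻¹ ,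
      subst₂ ℚ._≤_ (sym one) (sym (square m k)) (scale-mono le)

    isLower : ∀ m k → m ℕ.* m ℕ.* k ℕ.≤ N ℕ.* N → IsLower k (ℕtoℚ m ⊗ N⁻¹)
    isLower m k le = *-nonNeg (0≤ℕtoℚ m) 0≤N⁻¹ ,
      subst₂ ℚ._≤_ (sym (square m k)) (sym one) (scale-mono le)

    strict : ∀ {a b} → a ℕ.< b → ℕtoℚ a ⊗ N⁻¹ ℚ< ℕtoℚ b ⊗ N⁻¹
    strict a<b = ℚ.*-monoˡ-<-pos N⁻¹ {{ℚ.positive 0<N⁻¹}} (ℕtoℚ-mono-< a<b)

  -- The separating rational is `suc (SN.eval U x)` over `N`. It must lie strictly between the two
  -- sides, hence the demand for a gap of two units.
  <ᵣ-intro : ∀ (U L : ℕ → ℕ) x y →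
    All (λ ck → N ℕ.* N ℕ.≤ U (proj₂ ck) ℕ.* U (proj₂ ck) ℕ.* proj₂ ck) x →
    All (λ ck → L (proj₂ ck) ℕ.* L (proj₂ ck) ℕ.* proj₂ ck ℕ.≤ N ℕ.* N) y →
    suc (SN.eval U x) ℕ.< SN.eval L y → x <ᵣ y
  <ᵣ-intro U L x y ups los lt =
    ℕtoℚ (suc (SN.eval U x)) ⊗ N⁻¹ ,
    Below-intro (λ k → ℕtoℚ (U k) ⊗ N⁻¹) (All.map (λ {ck} → isUpper (U (proj₂ ck)) (proj₂ ck)) ups)
      (subst (ℚ._< ℕtoℚ (suc (SN.eval U x)) ⊗ N⁻¹) (sym (evalℚ-scale N⁻¹ U x)) (strict (ℕ.n<1+n (SN.eval U x)))) ,
    Above-intro (λ k → ℕtoℚ (L k) ⊗ N⁻¹) (All.map (λ {ck} → isLower (L (proj₂ ck)) (proj₂ ck)) los)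
      (subst (ℕtoℚ (suc (SN.eval U x)) ⊗ N⁻¹ ℚ.<_) (sym (evalℚ-scale N⁻¹ L y)) (strict lt))

-- If u < l held, then 1 ≤ u²k < l²k ≤ 1. For k = 0 there is no upper bound at all.
lower≤upper : ∀ k {l u} → IsLower k l → IsUpper k u → l ℚ≤ u
lower≤upper zero {u = u} _ (_ , 1≤) = ⊥-elim (ℚ.<-irrefl refl (ℚ.<-≤-trans (ℕtoℚ-mono-< {0} {1} (ℕ.s≤s ℕ.z≤n)) (subst (1ℚ ℚ.≤_) (ℚ.*-zeroʳ (u ⊗ u)) 1≤)))
lower≤upper k@(suc _) {l} {u} (0≤l , ll≤1) (0≤u , 1≤uu) with l ℚ.≤? u
... | yes l≤u = l≤u
... | no  l≰u = ⊥-elim (ℚ.<-irrefl refl (ℚ.<-≤-trans uuk<llk (ℚ.≤-trans ll≤1 1≤uu)))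
  where
  u<l = ℚ.≰⇒> l≰u
  uuk<llk : u ⊗ u ⊗ ℕtoℚ k ℚ< l ⊗ l ⊗ ℕtoℚ k
  uuk<llk = ℚ.*-monoˡ-<-pos (ℕtoℚ k) {{ℚ.positive (ℕtoℚ-mono-< {0} {k} (ℕ.s≤s ℕ.z≤n))}}
    (ℚ.≤-<-trans (ℚ.*-monoˡ-≤-nonNeg u {{ℚ.nonNegative 0≤u}} (ℚ.<⇒≤ u<l))
      (ℚ.*-monoˡ-<-pos l {{ℚ.positive (ℚ.≤-<-trans 0≤u u<l)}} u<l))

0-isLower : ∀ k → IsLower k 0ℚ
0-isLower k = ℚ.≤-refl , subst (ℚ._≤ 1ℚ) (sym (ℚ.*-zeroˡ (ℕtoℚ k))) (0≤ℕtoℚ 1)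

Below-elim : ∀ {l} → (∀ k → IsLower k (l k)) → ∀ e {q} → Below e q → evalℚ l e ℚ< q
Below-elim los []            lt           = lt
Below-elim {l} los ((c , k) ∷ e) {q} (u , up , b) = subst (evalℚ l ((c , k) ∷ e) ℚ.<_) (y-x+x≡y (ℕtoℚ c ⊗ u) q) (ℚ.+-mono-≤-<
  (ℚ.*-monoˡ-≤-nonNeg (ℕtoℚ c) {{ℚ.nonNegative (0≤ℕtoℚ c)}} (lower≤upper k (los k) up))
  (Below-elim los e b))

-- Different occurrences of the same k may carry different lower bounds; the
-- largest of them serves all occurrences at once.
Above-elim : ∀ e {q} → Above e q →
  Σ (ℕ → ℚ) λ l → (∀ k → IsLower k (l k)) × q ℚ< evalℚ l e
Above-elim [] lt = (λ _ → 0ℚ) , 0-isLower , lt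
Above-elim ((c , k) ∷ e) {q} (l₀ , lo , b) with Above-elim e b
... | l , los , lt = v , los′ , v>q
  where
  v : ℕ → ℚ
  v j with j ℕ.≟ k
  ... | yes _ = l₀ ℚ.⊔ l j
  ... | no  _ = l j
  v≥l : ∀ j → l j ℚ≤ v j
  v≥l j with j ℕ.≟ k
  ... | yes _ = ℚ.p≤q⊔p l₀ (l j)
  ... | no  _ = ℚ.≤-refl
  vk≥l₀ : l₀ ℚ≤ v k
  vk≥l₀ with k ℕ.≟ k
  ... | yes _ = ℚ.p≤p⊔q l₀ (l k)
  ... | no ¬p = ⊥-elim (¬p refl)
  los′ : ∀ j → IsLower j (v j)
  los′ j with j ℕ.≟ k
  ... | no  _    = los j
  ... | yes refl with ℚ.⊔-sel l₀ (l j)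
  ...   | inj₁ e = subst (IsLower j) (sym e) lo
  ...   | inj₂ e = subst (IsLower j) (sym e) (los j)
  v>q : q ℚ< evalℚ v ((c , k) ∷ e)
  v>q = subst (ℚ._< evalℚ v ((c , k) ∷ e)) (y-x+x≡y (ℕtoℚ c ⊗ l₀) q) (ℚ.+-mono-≤-<
    (ℚ.*-monoˡ-≤-nonNeg (ℕtoℚ c) {{ℚ.nonNegative (0≤ℕtoℚ c)}} vk≥l₀)
    (ℚ.<-≤-trans lt (evalℚ-mono v≥l e)))

-- `Above-elim` yields a single assignment `l` of lower bounds under which `y` exceeds `q`, and
-- `Below-elim` keeps `x` below `q` under the same `l`. Since `x` and `y` agree there, this is a
-- contradiction.
<ᵣ-absurd : ∀ x y → (∀ u → evalℚ u x ≡ evalℚ u y) → ¬ (x <ᵣ y)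
<ᵣ-absurd x y same (q , b , a) with Above-elim y a
... | l , los , q<l = ℚ.<-asym q<l (subst (ℚ._< q) (same l) (Below-elim los x b))

≈ᵣ-intro : ∀ x y → (∀ u → evalℚ u x ≡ evalℚ u y) → x ≈ᵣ y
≈ᵣ-intro x y same = <ᵣ-absurd x y same , <ᵣ-absurd y x (λ u → sym (same u))

open SN using (sum; sum-syntax; pick)

-- Sums and degrees

∑-mono : ∀ {n} {f g : Fin n → ℕ} → (∀ i → f i ≤ g i) → sum f ≤ sum g
∑-mono {zero}  le = z≤n
∑-mono {suc n} le = ℕ.+-mono-≤ (le zero) (∑-mono (le ∘ suc))

∑-≤-tight : ∀ {n} {f g : Fin n → ℕ} → (∀ i → f i ≤ g i) → sum g ≤ sum f → ∀ i → f i ≡ g i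
∑-≤-tight {suc n} {f} {g} le ge zero = ℕ.≤-antisym (le zero)
  (ℕ.+-cancelʳ-≤ (sum (f ∘ suc)) _ _ (ℕ.≤-trans (ℕ.+-monoʳ-≤ (g zero) (∑-mono (le ∘ suc))) ge))
∑-≤-tight {suc n} {f} {g} le ge (suc i) = ∑-≤-tight (le ∘ suc)
  (ℕ.+-cancelˡ-≤ (f zero) _ _ (ℕ.≤-trans (ℕ.+-monoˡ-≤ _ (le zero)) ge)) i

term≤∑ : ∀ {n} (f : Fin n → ℕ) i → f i ≤ sum f
term≤∑ f zero    = ℕ.m≤m+n _ _
term≤∑ f (suc i) = ℕ.≤-trans (term≤∑ (f ∘ suc) i) (ℕ.m≤n+m _ (f zero))

count : ∀ {n} → (Fin n → Bool) → ℕ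
count {n} b = ∑[ i < n ] pick (b i) 1

deg≡count : ∀ {n} (G : Graph n) i → deg G i ≡ count (adj G i)
deg≡count G i = sym (trans (SN.∑-adj-const G i 1) (trans (×≡* (deg G i) 1) (ℕ.*-identityʳ _)))

volume : ∀ {n} → Graph n → ℕ
volume {n} G = ∑[ i < n ] deg G i

volume≡∑∑ : ∀ {n} (G : Graph n) → volume G ≡ ∑[ i < n ] count (adj G i)
volume≡∑∑ {n} G = SN.sum-cong-≋ {n} (deg≡count G)

pick-≟-diag : ∀ {n} (v : Fin n) → does (v F.≟ v) ≡ true
pick-≟-diag v = dec-true (v F.≟ v) refl

length≤count : ∀ {n} (b : Fin n → Bool) {ys} → Unique ys → All (λ y → b y ≡ true) ys → length ys ≤ count b
length≤count b [] [] = z≤n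
length≤count {n} b {y ∷ ys} (y∉ys ∷ u) (by ∷ bys) = begin
  suc (length ys)                                       ≤⟨ s≤s (length≤count b′ u (All.zipWith keep (y∉ys , bys))) ⟩
  suc (count b′)                                        ≡⟨ cong (_+ count b′) (SN.∑-pick-≟ y 1) ⟨
  ∑[ i < n ] pick (does (i F.≟ y)) 1 + count b′         ≡⟨ SN.∑-distrib-+ {n} _ _ ⟨
  ∑[ i < n ] (pick (does (i F.≟ y)) 1 + pick (b′ i) 1)  ≡⟨ SN.sum-cong-≋ {n} split ⟨
  count b                                               ∎
  where
  open ℕ.≤-Reasoning
  b′ : Fin n → Bool
  b′ i = b i ∧ not (does (i F.≟ y))
  keep : ∀ {z} → y ≢ z × b z ≡ true → b′ z ≡ true
  keep {z} (y≢z , bz) rewrite bz | dec-false (z F.≟ y) (y≢z ∘ sym) = refl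
  split : ∀ i → pick (b i) 1 ≡ pick (does (i F.≟ y)) 1 + pick (b′ i) 1
  split i with i F.≟ y
  ... | yes refl rewrite by = refl
  ... | no _ with b i
  ...   | true  = refl
  ...   | false = refl

count≤length : ∀ {n} (b : Fin n → Bool) ys → (∀ i → b i ≡ true → i ∈ ys) → count b ≤ length ys
count≤length {n} b [] none = ℕ.≤-trans (∑-mono λ i → zero-at i) (ℕ.≤-reflexive (SN.sum-replicate-zero n))
  where
  zero-at : ∀ i → pick (b i) 1 ≤ 0
  zero-at i with b i | none i
  ... | false | _ = z≤n
  ... | true  | f with f refl
  ...   | ()
count≤length {n} b (y ∷ ys) all∈ = begin
  count b                                               ≤⟨ ∑-mono split ⟩
  ∑[ i < n ] (pick (does (i F.≟ y)) 1 + pick (b′ i) 1)  ≡⟨ SN.∑-distrib-+ {n} _ _ ⟩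
  ∑[ i < n ] pick (does (i F.≟ y)) 1 + count b′         ≡⟨ cong (_+ count b′) (SN.∑-pick-≟ y 1) ⟩
  suc (count b′)                                        ≤⟨ s≤s (count≤length b′ ys all∈′) ⟩
  suc (length ys)                                       ∎
  where
  open ℕ.≤-Reasoning
  b′ : Fin n → Bool
  b′ i = b i ∧ not (does (i F.≟ y))
  split : ∀ i → pick (b i) 1 ≤ pick (does (i F.≟ y)) 1 + pick (b′ i) 1
  split i with b i | does (i F.≟ y)
  ... | false | _     = z≤n
  ... | true  | true  = s≤s z≤n
  ... | true  | false = s≤s z≤n
  all∈′ : ∀ i → b′ i ≡ true → i ∈ ys
  all∈′ i e with b i | all∈ i | i F.≟ y
  all∈′ i () | true  | _ | yes _
  all∈′ i () | false | _ | _
  ... | true | f | no i≢y with f refl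
  ...   | here i≡y  = ⊥-elim (i≢y i≡y)
  ...   | there i∈ys = i∈ys

deg≤length : ∀ {n} (G : Graph n) v ys → (∀ z → adj G v z ≡ true → z ∈ ys) → deg G v ≤ length ys
deg≤length G v ys all∈ = subst (_≤ length ys) (sym (deg≡count G v)) (count≤length (adj G v) ys all∈)

length≤deg : ∀ {n} (G : Graph n) v {ys} → Unique ys → All (λ y → adj G v y ≡ true) ys → length ys ≤ deg G v
length≤deg G v u as = subst (_ ≤_) (sym (deg≡count G v)) (length≤count (adj G v) u as)

-- A neighbour outside the list would extend it to more distinct neighbours than the degree allows.
neighbours-exhausted : ∀ {n} (G : Graph n) v {ys} → Unique ys → All (λ y → adj G v y ≡ true) ys →
  deg G v ≤ length ys → ∀ {z} → adj G v z ≡ true → z ∈ ys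
neighbours-exhausted G v {ys} u as d≤ {z} vz with ∈? F._≟_ z ys
... | yes z∈ys = z∈ys
... | no  z∉ys = ⊥-elim (ℕ.<⇒≱ (length≤deg G v (¬Any⇒All¬ ys z∉ys ∷ u) (vz ∷ as)) d≤)

new-neighbour : ∀ {n} (G : Graph n) v ys → length ys < deg G v → ∃ λ c → ¬ c ∈ ys × adj G v c ≡ true
new-neighbour G v ys d> with F.any? (λ c → ¬? (∈? F._≟_ c ys) ×-dec (adj G v c ≟ᵇ true))
... | yes found = found
... | no  none  = ⊥-elim (ℕ.<⇒≱ d> (deg≤length G v ys only-ys))
  where
  only-ys : ∀ z → adj G v z ≡ true → z ∈ ys
  only-ys z vz with ∈? F._≟_ z ys
  ... | yes z∈ys = z∈ys
  ... | no  z∉ys = ⊥-elim (none (z , z∉ys , vz))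

adj-≢ : ∀ {n} (G : Graph n) {u v} → adj G u v ≡ true → u ≢ v
adj-≢ G {u} uv refl with trans (sym uv) (Graph.irrefl G u)
... | ()

-- Walks and cycles

InjectiveBelow : ∀ {n} → (ℕ → Fin n) → ℕ → Set
InjectiveBelow p k = ∀ {a b} → a < k → b < k → p a ≡ p b → a ≡ b

injectiveBelow⇒≤ : ∀ {n} (p : ℕ → Fin n) {k} → InjectiveBelow p k → k ≤ n
injectiveBelow⇒≤ p inj = F.injective⇒≤ {f = p ∘ toℕ} λ {a} {b} e →
  F.toℕ-injective (inj (F.toℕ<n a) (F.toℕ<n b) e)

Unique-map : ∀ {n} (p : ℕ → Fin n) {k} → InjectiveBelow p k → ∀ {xs} → All (_< k) xs → Unique xs → Unique (map p xs)
Unique-map p inj [] [] = []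
Unique-map p inj (x< ∷ xs<) (x∉ ∷ u) =
  map⁺ (All.zipWith (λ { (y< , x≢y) e → x≢y (inj x< y< e) }) (xs< , x∉)) ∷ Unique-map p inj xs< u

FirstRepeat : ∀ {n} → (ℕ → Fin n) → ℕ → ℕ → Set
FirstRepeat p i j = i < j × p i ≡ p j × InjectiveBelow p j

-- Pigeonhole: a walk in n vertices cannot be injective on its first n + 1 places.
first-repeat : ∀ {n} (p : ℕ → Fin n) → ∃₂ (FirstRepeat p)
first-repeat {n} p with search (suc n)
  where
  search : ∀ k → InjectiveBelow p k ⊎ ∃₂ (FirstRepeat p)
  search zero = inj₁ λ ()
  search (suc k) with search k
  ... | inj₂ r   = inj₂ r
  ... | inj₁ inj with F.any? {k} (λ i → p (toℕ i) F.≟ p k)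
  ...   | yes (i , e) = inj₂ (toℕ i , k , F.toℕ<n i , e , inj)
  ...   | no  none    = inj₁ extend
    where
    fresh : ∀ {a} → a < k → p a ≢ p k
    fresh a<k e = none (F.fromℕ< a<k , trans (cong p (F.toℕ-fromℕ< a<k)) e)
    extend : InjectiveBelow p (suc k)
    extend (s≤s a≤k) (s≤s b≤k) e with ℕ.m≤n⇒m<n∨m≡n a≤k | ℕ.m≤n⇒m<n∨m≡n b≤k
    ... | inj₁ a<k  | inj₁ b<k  = inj a<k b<k e
    ... | inj₁ a<k  | inj₂ refl = ⊥-elim (fresh a<k e)
    ... | inj₂ refl | inj₁ b<k  = ⊥-elim (fresh b<k (sym e))
    ... | inj₂ refl | inj₂ refl = refl
... | inj₂ r   = r
... | inj₁ inj = ⊥-elim (ℕ.<⇒≱ ℕ.≤-refl (injectiveBelow⇒≤ p inj))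

-- At a vertex of degree 1 a walk has no choice but to return, so `turns` speaks only of vertices of
-- degree at least 2. This lets a walk be defined for all times, even in graphs with leaves.
record NonBacktracking {n} (G : Graph n) (p : ℕ → Fin n) : Set where
  field
    follows : ∀ i → adj G (p i) (p (suc i)) ≡ true
    turns   : ∀ i → 2 ≤ deg G (p (suc i)) → p (suc (suc i)) ≢ p i
open NonBacktracking

repeat-gap : ∀ {n} (G : Graph n) {p} → NonBacktracking G p → ∀ i {d} →
  2 ≤ deg G (p (suc i)) → 0 < d → p i ≡ p (d + i) → 3 ≤ d
repeat-gap G nb i {suc zero}          _  _ e = ⊥-elim (adj-≢ G (follows nb i) e)
repeat-gap G nb i {suc (suc zero)}    2≤ _ e = ⊥-elim (turns nb i 2≤ (sym e))
repeat-gap G nb i {suc (suc (suc d))} _  _ e = s≤s (s≤s (s≤s z≤n))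

Chain-applyUpTo : ∀ {n} (G : Graph n) (f : ℕ → Fin n) l {x} →
  (∀ t → adj G (f t) (f (suc t)) ≡ true) → adj G (f l) x ≡ true → Chain G (applyUpTo f (suc l) ++ [ x ])
Chain-applyUpTo G f zero    e last = last , _
Chain-applyUpTo G f (suc l) e last = e 0 , Chain-applyUpTo G (f ∘ suc) l (e ∘ suc) last

-- The stretch between the two visits to the first repeated vertex has no other repetition, and
-- `repeat-gap` makes it long enough to be a cycle.
cycle-of-walk : ∀ {n} (G : Graph n) {p} → NonBacktracking G p → (∀ v → 2 ≤ deg G v) → ∃ (IsCycle G)
cycle-of-walk G {p} nb 2≤ with first-repeat p
... | i , j , i<j , e , inj with j ∸ i | ℕ.m∸n+n≡m (ℕ.<⇒≤ i<j) | ℕ.m<n⇒0<n∸m i<j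
...   | suc l | refl | 0<d = applyUpTo f (suc l) ,
  subst (3 ≤_) (sym (length-applyUpTo f (suc l))) (repeat-gap G nb i (2≤ _) 0<d e) ,
  Unique.applyUpTo⁺₁ f (suc l) (λ a<b b<d → ℕ.<⇒≢ a<b ∘ ℕ.+-cancelʳ-≡ i _ _ ∘
    inj (ℕ.+-monoˡ-< i (ℕ.<-trans a<b b<d)) (ℕ.+-monoˡ-< i b<d)) ,
  Chain-applyUpTo G f l (λ t → follows nb (t + i)) (subst (λ z → adj G (p (l + i)) z ≡ true) (sym e) (follows nb (l + i)))
  where
  f : ℕ → Fin _
  f t = p (t + i)

module Walk {n} (G : Graph n) {a b} (ab : adj G a b ≡ true) where
  private
    Dart : Set
    Dart = ∃₂ λ a b → adj G a b ≡ true

    next : ∀ a b → adj G a b ≡ true → ∃ λ c → adj G b c ≡ true × (2 ≤ deg G b → c ≢ a)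
    next a b ab with 2 ℕ.≤? deg G b
    ... | no  ¬2≤ = a , trans (Graph.sym G b a) ab , (λ 2≤ → ⊥-elim (¬2≤ 2≤))
    ... | yes 2≤ = let c , c∉ , bc = new-neighbour G b [ a ] 2≤ in c , bc , λ _ → c∉ ∘ here

    dart : ℕ → Dart
    dart zero    = a , b , ab
    dart (suc i) = let a , b , ab = dart i ; c , bc , _ = next a b ab in b , c , bc

  walk : ℕ → Fin n
  walk i = proj₁ (dart i)

  walk-nonBacktracking : NonBacktracking G walk
  walk-nonBacktracking .follows i = proj₂ (proj₂ (dart i))
  walk-nonBacktracking .turns i = let a , b , ab = dart i in proj₂ (proj₂ (next a b ab))

Chain-map : ∀ {m n} (G : Graph m) (H : Graph n) (f : Fin m → Fin n) →
  (∀ i j → adj G i j ≡ true → adj H (f i) (f j) ≡ true) → ∀ c → Chain G c → Chain H (map f c)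
Chain-map G H f hom []          _        = _
Chain-map G H f hom (x ∷ [])    _        = _
Chain-map G H f hom (x ∷ y ∷ c) (e , es) = hom x y e , Chain-map G H f hom (y ∷ c) es

IsCycle-map : ∀ {m n} (G : Graph m) (H : Graph n) (f : Fin m → Fin n) →
  (∀ {i j} → f i ≡ f j → i ≡ j) → (∀ i j → adj G i j ≡ true → adj H (f i) (f j) ≡ true) →
  ∀ c → IsCycle G c → IsCycle H (map f c)
IsCycle-map G H f inj hom (x ∷ xs) (3≤ , u , ch) =
  subst (3 ≤_) (sym (cong suc (length-map f xs))) 3≤ , Unique.map⁺ inj u ,
  subst (Chain H) (map-++ f (x ∷ xs) [ x ]) (Chain-map G H f hom _ ch)

InChain⇒adj : ∀ {n} (G : Graph n) c → Chain G c → ∀ {u v} → InChain c u v → adj G u v ≡ true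
InChain⇒adj G (x ∷ y ∷ c) (e , _)  (inj₁ (refl , refl))        = e
InChain⇒adj G (x ∷ y ∷ c) (e , _)  (inj₂ (inj₁ (refl , refl))) = trans (Graph.sym G y x) e
InChain⇒adj G (x ∷ y ∷ c) (_ , es) (inj₂ (inj₂ i))             = InChain⇒adj G (y ∷ c) es i

CycleEdge⇒adj : ∀ {n} (G : Graph n) c → IsCycle G c → ∀ {u v} → CycleEdge c u v → adj G u v ≡ true
CycleEdge⇒adj G (x ∷ xs) (_ , _ , ch) = InChain⇒adj G (x ∷ xs ++ [ x ]) ch

-- Counting edges of graphs with at most one cycle

delete : ∀ {n} → Graph (suc n) → Fin (suc n) → Graph n
delete G v .adj i j        = adj G (punchIn v i) (punchIn v j)
delete G v .Graph.sym i j  = Graph.sym G (punchIn v i) (punchIn v j)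
delete G v .Graph.irrefl i = Graph.irrefl G (punchIn v i)

volume-delete : ∀ {n} (G : Graph (suc n)) v → volume G ≡ deg G v + (deg G v + volume (delete G v))
volume-delete {n} G v = begin
  volume G
    ≡⟨ SN.sum-remove {n} {v} (deg G) ⟩
  deg G v + ∑[ i < n ] deg G (punchIn v i)
    ≡⟨ cong (deg G v +_) (SN.sum-cong-≋ {n} row) ⟩
  deg G v + ∑[ i < n ] (bit v (punchIn v i) + deg (delete G v) i)
    ≡⟨ cong (deg G v +_) (SN.∑-distrib-+ {n} _ _) ⟩
  deg G v + (∑[ i < n ] bit v (punchIn v i) + volume (delete G v))
    ≡⟨ cong (λ z → deg G v + (z + volume (delete G v))) column ⟩
  deg G v + (deg G v + volume (delete G v)) ∎
  where
  open ≡-Reasoning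
  bit : Fin (suc n) → Fin (suc n) → ℕ
  bit i j = pick (adj G i j) 1
  row : ∀ i → deg G (punchIn v i) ≡ bit v (punchIn v i) + deg (delete G v) i
  row i = begin
    deg G (punchIn v i)                                       ≡⟨ deg≡count G (punchIn v i) ⟩
    count (adj G (punchIn v i))                               ≡⟨ SN.sum-remove {n} {v} (bit (punchIn v i)) ⟩
    bit (punchIn v i) v + count (adj (delete G v) i)          ≡⟨ cong₂ _+_ (cong (λ b → pick b 1) (Graph.sym G (punchIn v i) v)) (sym (deg≡count (delete G v) i)) ⟩
    bit v (punchIn v i) + deg (delete G v) i                  ∎
  column : ∑[ i < n ] bit v (punchIn v i) ≡ deg G v
  column = begin
    ∑[ i < n ] bit v (punchIn v i)              ≡⟨ cong (λ b → pick b 1 + ∑[ i < n ] bit v (punchIn v i)) (Graph.irrefl G v) ⟨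
    bit v v + ∑[ i < n ] bit v (punchIn v i)    ≡⟨ SN.sum-remove {n} {v} (bit v) ⟨
    count (adj G v)                             ≡⟨ deg≡count G v ⟨
    deg G v                                     ∎

-- If all degrees are at least 2, a walk closes up to a cycle. Otherwise deleting a vertex of degree
-- at most 1 lowers both sides suitably: the left by 2, the degree sum by at most 2. The `suc` on
-- the right does the work of parity: a degree sum of at least 2n + 1 is still at least 2n - 1 after
-- an edge is removed, and that has to be enough.
∃-cycle : ∀ n (G : Graph (suc n)) → 2 * suc n ≤ suc (volume G) → ∃ (IsCycle G)
∃-cycle n G big with F.any? (λ v → deg G v ℕ.≤? 1)
... | no  none = cycle-of-walk G (Walk.walk-nonBacktracking G (proj₂ (proj₂ (new-neighbour G zero [] (ℕ.<⇒≤ (2≤ zero)))))) 2≤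
  where
  2≤ : ∀ v → 2 ≤ deg G v
  2≤ v = ℕ.≰⇒> λ le → none (v , le)
∃-cycle zero G big | yes (v , d≤1) = ⊥-elim (ℕ.<⇒≱ big (s≤s (ℕ.≤-reflexive vol0)))
  where
  vol0 : volume G ≡ 0
  vol0 rewrite Graph.irrefl G zero = refl
∃-cycle (suc n) G big | yes (v , d≤1) = map (punchIn v) (proj₁ c) ,
  IsCycle-map (delete G v) G (punchIn v) (F.punchIn-injective v _ _) (λ _ _ e → e) (proj₁ c) (proj₂ c)
  where
  c : ∃ (IsCycle (delete G v))
  c = ∃-cycle n (delete G v) (ℕ.+-cancelˡ-≤ 2 _ _ (begin
    2 + 2 * suc n                                   ≡⟨ ℕ.*-suc 2 (suc n) ⟨
    2 * suc (suc n)                                 ≤⟨ big ⟩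
    suc (volume G)                                  ≡⟨ cong suc (volume-delete G v) ⟩
    suc (deg G v + (deg G v + volume (delete G v))) ≤⟨ s≤s (ℕ.+-mono-≤ d≤1 (ℕ.+-monoˡ-≤ _ d≤1)) ⟩
    2 + suc (volume (delete G v))                   ∎))
    where open ℕ.≤-Reasoning

module _ {n} (G : Graph n) (a b : Fin n) where
  private
    isEdge : Fin n → Fin n → Bool
    isEdge i j = (does (i F.≟ a) ∧ does (j F.≟ b)) ∨ (does (j F.≟ a) ∧ does (i F.≟ b))

  removeEdge : Graph n
  removeEdge .adj i j        = adj G i j ∧ not (isEdge i j)
  removeEdge .Graph.sym i j  = cong₂ (λ x y → x ∧ not y) (Graph.sym G i j) (∨-comm (does (i F.≟ a) ∧ does (j F.≟ b)) _)
  removeEdge .Graph.irrefl i = cong (_∧ not (isEdge i i)) (Graph.irrefl G i)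

  removeEdge⇒adj : ∀ i j → adj removeEdge i j ≡ true → adj G i j ≡ true
  removeEdge⇒adj i j e with adj G i j
  ... | true = refl

  removeEdge-removed : adj removeEdge a b ≢ true
  removeEdge-removed e rewrite pick-≟-diag a | pick-≟-diag b | ∧-zeroʳ (adj G a b) with e
  ... | ()

  volume-removeEdge : volume G ≤ 2 + volume removeEdge
  volume-removeEdge = begin
    volume G
      ≡⟨ volume≡∑∑ G ⟩
    ∑[ i < n ] count (adj G i)
      ≤⟨ ∑-mono (λ i → ∑-mono (split i)) ⟩
    ∑[ i < n ] ∑[ j < n ] (δ i a (δ j b 1) + δ j a (δ i b 1) + pick (adj removeEdge i j) 1)
      ≡⟨ SN.sum-cong-≋ {n} row ⟩
    ∑[ i < n ] (δ i a 1 + δ i b 1 + deg removeEdge i)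
      ≡⟨ trans (SN.∑-distrib-+ {n} _ _) (cong (_+ volume removeEdge) (SN.∑-distrib-+ {n} _ _)) ⟩
    ∑[ i < n ] δ i a 1 + ∑[ i < n ] δ i b 1 + volume removeEdge
      ≡⟨ cong (_+ volume removeEdge) (cong₂ _+_ (SN.∑-pick-≟ a 1) (SN.∑-pick-≟ b 1)) ⟩
    2 + volume removeEdge ∎
    where
    open ℕ.≤-Reasoning
    δ : Fin n → Fin n → ℕ → ℕ
    δ i j x = pick (does (i F.≟ j)) x
    split : ∀ i j → pick (adj G i j) 1 ≤ δ i a (δ j b 1) + δ j a (δ i b 1) + pick (adj removeEdge i j) 1
    split i j with adj G i j | does (i F.≟ a) | does (j F.≟ b) | does (j F.≟ a) | does (i F.≟ b)
    ... | false | _     | _     | _     | _     = z≤n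
    ... | true  | true  | true  | _     | _     = s≤s z≤n
    ... | true  | true  | false | true  | true  = s≤s z≤n
    ... | true  | true  | false | true  | false = s≤s z≤n
    ... | true  | true  | false | false | _     = s≤s z≤n
    ... | true  | false | _     | true  | true  = s≤s z≤n
    ... | true  | false | _     | true  | false = s≤s z≤n
    ... | true  | false | _     | false | _     = s≤s z≤n
    ∑-δ : ∀ i j x → ∑[ k < n ] δ i j (δ k x 1) ≡ δ i j 1
    ∑-δ i j x with does (i F.≟ j)
    ... | true  = SN.∑-pick-≟ x 1
    ... | false = SN.sum-replicate-zero n
    row : ∀ i → ∑[ j < n ] (δ i a (δ j b 1) + δ j a (δ i b 1) + pick (adj removeEdge i j) 1)
      ≡ δ i a 1 + δ i b 1 + deg removeEdge i
    row i = trans (SN.∑-distrib-+ {n} _ _) (cong₂ _+_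
      (trans (SN.∑-distrib-+ {n} _ _) (cong₂ _+_ (∑-δ i a b) (SN.∑-pick-≟ a (δ i b 1))))
      (sym (deg≡count removeEdge i)))

-- With a larger degree sum, a cycle survives the removal of one edge of the given cycle. It is also
-- a cycle of `G`, so by uniqueness it contains the removed edge.
unicyclic⇒volume≤ : ∀ {n} (G : Graph n) → Unicyclic G → volume G ≤ 2 * n
unicyclic⇒volume≤ {suc n} G (_ , x ∷ y ∷ r , cyc , unique) = ℕ.≮⇒≥ λ big →
  let c , cyc-c = ∃-cycle n G′ (ℕ.≤-pred (ℕ.≤-trans big (volume-removeEdge G x y)))
      cyc-c′ = subst (IsCycle G) (map-id c)
                 (IsCycle-map G′ G (λ i → i) (λ e → e) (removeEdge⇒adj G x y) c cyc-c)
  in removeEdge-removed G x y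
       (CycleEdge⇒adj G′ c cyc-c (proj₁ (unique c cyc-c′ x y) (inj₁ (refl , refl))))
  where
  G′ = removeEdge G x y
unicyclic⇒volume≤ {zero} G (_ , () ∷ _ , _)
unicyclic⇒volume≤ {suc n} G (_ , x ∷ [] , (s≤s () , _) , _)

-- Cycles with an attached path

-- The path 0, 1, …, ℓ closed up by the edge from ℓ back to m.
data Link (m ℓ : ℕ) : ℕ → ℕ → Set where
  up    : ∀ {a} → Link m ℓ a (suc a)
  down  : ∀ {a} → Link m ℓ (suc a) a
  close : Link m ℓ m ℓ
  reopen : Link m ℓ ℓ m

Link-sym : ∀ {m ℓ a b} → Link m ℓ a b → Link m ℓ b a
Link-sym up     = down
Link-sym down   = up
Link-sym close  = reopen
Link-sym reopen = close

-- In `size` the correction for the leaf stands on the left and that for the branch vertex on the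
-- right. For m = 0 both fall on the same vertex and cancel, so the plain cycle obeys the same
-- formula.
record Linked (m ℓ a : ℕ) : Set where
  field
    list     : List ℕ
    unique   : Unique list
    sound    : All (λ b → Link m ℓ a b × b ≤ ℓ) list
    complete : ∀ {b} → Link m ℓ a b → b ≤ ℓ → b ∈ list
    size     : length list + pick (does (a ℕ.≟ 0)) 1 ≡ 2 + pick (does (a ℕ.≟ m)) 1

linked : ∀ {m ℓ} → m + 2 ≤ ℓ → ∀ a → a ≤ ℓ → Linked m ℓ a
linked {zero} {suc zero} (s≤s ()) zero a≤ℓ
linked {zero} {suc (suc ℓ)} gap zero a≤ℓ = record
  { list     = 1 ∷ suc (suc ℓ) ∷ []
  ; unique   = ((λ ()) ∷ []) ∷ [] ∷ []
  ; sound    = (up , s≤s z≤n) ∷ (close , ℕ.≤-refl) ∷ []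
  ; complete = λ { up _ → here refl ; close _ → there (here refl) }
  ; size     = refl }
linked {suc m} {suc ℓ} gap zero a≤ℓ = record
  { list     = 1 ∷ []
  ; unique   = [] ∷ []
  ; sound    = (up , s≤s z≤n) ∷ []
  ; complete = λ { up _ → here refl }
  ; size     = refl }
linked {m} {ℓ} gap (suc a) a≤ℓ with ℕ.m≤n⇒m<n∨m≡n a≤ℓ
... | inj₂ refl = record
  { list     = a ∷ m ∷ []
  ; unique   = (ℕ.>⇒≢ m<a ∷ []) ∷ [] ∷ []
  ; sound    = (down , ℕ.n≤1+n a) ∷ (reopen , ℕ.≤-trans (ℕ.<⇒≤ m<a) (ℕ.n≤1+n a)) ∷ []
  ; complete = λ { up b≤ℓ → ⊥-elim (ℕ.<⇒≱ ℕ.≤-refl b≤ℓ) ; down _ → here refl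
                 ; close _ → ⊥-elim (ℕ.<⇒≢ (ℕ.m<n⇒m<1+n m<a) refl) ; reopen _ → there (here refl) }
  ; size     = cong (λ b → 2 + pick b 1) (sym (dec-false (suc a ℕ.≟ m) (ℕ.>⇒≢ (ℕ.m<n⇒m<1+n m<a)))) }
  where
  m<a : m < a
  m<a = ℕ.≤-pred (subst (_≤ suc a) (ℕ.+-comm m 2) gap)
... | inj₁ a<ℓ with suc a ℕ.≟ m
...   | yes refl = record
  { list     = a ∷ suc (suc a) ∷ ℓ ∷ []
  ; unique   = (ℕ.<⇒≢ (ℕ.<-trans (ℕ.n<1+n _) (ℕ.n<1+n _)) ∷ ℕ.<⇒≢ (ℕ.<-trans (ℕ.n<1+n _) a<ℓ) ∷ []) ∷ (ℕ.<⇒≢ far ∷ []) ∷ [] ∷ []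
  ; sound    = (down , ℕ.≤-trans (ℕ.n≤1+n a) a≤ℓ) ∷ (up , a<ℓ) ∷ (close , ℕ.≤-refl) ∷ []
  ; complete = λ { up _ → there (here refl) ; down _ → here refl
                 ; close _ → there (there (here refl)) ; reopen _ → ⊥-elim (ℕ.<⇒≢ a<ℓ refl) }
  ; size     = cong (λ b → 2 + pick b 1) (sym (dec-true (suc a ℕ.≟ suc a) refl)) }
  where
  far : suc (suc a) < ℓ
  far = subst (_≤ ℓ) (ℕ.+-comm (suc a) 2) gap
...   | no a≢m = record
  { list     = a ∷ suc (suc a) ∷ []
  ; unique   = (ℕ.<⇒≢ (ℕ.<-trans (ℕ.n<1+n _) (ℕ.n<1+n _)) ∷ []) ∷ [] ∷ []
  ; sound    = (down , ℕ.≤-trans (ℕ.n≤1+n a) a≤ℓ) ∷ (up , a<ℓ) ∷ []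
  ; complete = λ { up _ → there (here refl) ; down _ → here refl
                 ; close _ → ⊥-elim (a≢m refl) ; reopen _ → ⊥-elim (ℕ.<⇒≢ a<ℓ refl) }
  ; size     = cong (λ b → 2 + pick b 1) (sym (dec-false (suc a ℕ.≟ m) a≢m)) }

-- A labelling that starts at the leaf: `m` is the length of the tail and the loop occupies the
-- places from `m` to `ℓ`. The case m = 0 is the cycle itself, and `gap` gives the loop at least
-- three vertices.
record IsLasso {ℓ} (m : ℕ) (G : Graph (suc ℓ)) : Set where
  field
    gap      : m + 2 ≤ ℓ
    p        : ℕ → Fin (suc ℓ)
    inj      : InjectiveBelow p (suc ℓ)
    index    : Fin (suc ℓ) → ℕ
    index≤ℓ  : ∀ v → index v ≤ ℓ
    p-index  : ∀ v → p (index v) ≡ v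
    link⇒adj : ∀ {a b} → a ≤ ℓ → b ≤ ℓ → Link m ℓ a b → adj G (p a) (p b) ≡ true
    adj⇒link : ∀ {a b} → a ≤ ℓ → b ≤ ℓ → adj G (p a) (p b) ≡ true → Link m ℓ a b

  index-p : ∀ {a} → a ≤ ℓ → index (p a) ≡ a
  index-p a≤ℓ = inj (s≤s (index≤ℓ _)) (s≤s a≤ℓ) (p-index _)

  m≤ℓ : m ≤ ℓ
  m≤ℓ = ℕ.≤-trans (ℕ.m≤m+n m 2) gap

  adj⇒link′ : ∀ {u v} → adj G u v ≡ true → Link m ℓ (index u) (index v)
  adj⇒link′ {u} {v} e = adj⇒link (index≤ℓ u) (index≤ℓ v)
    (subst₂ (λ x y → adj G x y ≡ true) (sym (p-index u)) (sym (p-index v)) e)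

  deg-lasso : ∀ u → deg G u + pick (does (u F.≟ p 0)) 1 ≡ 2 + pick (does (u F.≟ p m)) 1
  deg-lasso u = trans (cong₂ _+_ deg≡ (cong (λ b → pick b 1) (at 0 z≤n)))
      (trans size (cong (λ b → 2 + pick b 1) (sym (at m m≤ℓ))))
    where
    open Linked (linked gap (index u) (index≤ℓ u))
    at : ∀ a → a ≤ ℓ → does (u F.≟ p a) ≡ does (index u ℕ.≟ a)
    at a a≤ℓ = does-⇔ (mk⇔ (λ e → trans (cong index e) (index-p a≤ℓ)) (λ e → trans (sym (p-index u)) (cong p e)))
      (u F.≟ p a) (index u ℕ.≟ a)
    deg≡ : deg G u ≡ length list
    deg≡ = trans (ℕ.≤-antisym
      (deg≤length G u (map p list) λ z e → subst (_∈ map p list) (p-index z) (∈-map⁺ p (complete (adj⇒link′ e) (index≤ℓ z))))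
      (length≤deg G u (Unique-map p inj (All.map (s≤s ∘ proj₂) sound) unique)
        (map⁺ (All.map (λ { {b} (l , b≤) → subst (λ x → adj G x (p b) ≡ true) (p-index u) (link⇒adj (index≤ℓ u) b≤ l) }) sound))))
      (length-map p list)

  reach : ∀ {a} → a ≤ ℓ → Reach G (p 0) (p a) × Reach G (p a) (p 0)
  reach {zero}  _ = here , here
  reach {suc a} a<ℓ with reach {a} (ℕ.<⇒≤ a<ℓ)
  ... | to , from = append to (link⇒adj (ℕ.<⇒≤ a<ℓ) a<ℓ up) , step (link⇒adj a<ℓ (ℕ.<⇒≤ a<ℓ) down) from
    where
    append : ∀ {u v w} → Reach G u v → adj G v w ≡ true → Reach G u w
    append here       e = step e here
    append (step d r) e = step d (append r e)

  connected : Connected G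
  connected u v = subst₂ (Reach G) (p-index u) (p-index v)
    (proj₂ (reach (index≤ℓ u)) ∙ proj₁ (reach (index≤ℓ v)))
    where
    _∙_ : ∀ {u v w} → Reach G u v → Reach G v w → Reach G u w
    here     ∙ s = s
    step d r ∙ s = step d (r ∙ s)

∑-2+mark : ∀ {n} (v : Fin n) → ∑[ u < n ] (2 + pick (does (u F.≟ v)) 1) ≡ 2 * n + 1
∑-2+mark {n} v = trans (SN.∑-distrib-+ {n} _ _)
  (cong₂ _+_ (trans (SN.sum-replicate n) (trans (×≡* n 2) (ℕ.*-comm n 2))) (SN.∑-pick-≟ v 1))

∑-deg+mark : ∀ {n} (G : Graph n) w → ∑[ u < n ] (deg G u + pick (does (u F.≟ w)) 1) ≡ volume G + 1
∑-deg+mark {n} G w = trans (SN.∑-distrib-+ {n} _ _) (cong (volume G +_) (SN.∑-pick-≟ w 1))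

marked⇒volume : ∀ {n} (G : Graph n) {v w} →
  (∀ u → deg G u + pick (does (u F.≟ w)) 1 ≡ 2 + pick (does (u F.≟ v)) 1) → volume G ≡ 2 * n
marked⇒volume {n} G {v} {w} D = ℕ.+-cancelʳ-≡ 1 _ _
  (trans (sym (∑-deg+mark G w)) (trans (SN.sum-cong-≋ {n} D) (∑-2+mark v)))

data LassoDegree {ℓ m} {G : Graph (suc ℓ)} (L : IsLasso m G) (u : Fin (suc ℓ)) : Set where
  leaf   : u ≡ IsLasso.p L 0 → deg G u ≡ 1 → LassoDegree L u
  branch : u ≡ IsLasso.p L m → deg G u ≡ 3 → LassoDegree L u
  inner  : u ≢ IsLasso.p L 0 → u ≢ IsLasso.p L m → deg G u ≡ 2 → LassoDegree L u

module _ {ℓ m} {G : Graph (suc ℓ)} (L : IsLasso (suc m) G) where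
  open IsLasso L

  lasso-ends-distinct : p 0 ≢ p (suc m)
  lasso-ends-distinct e with inj (s≤s z≤n) (s≤s m≤ℓ) e
  ... | ()

  lasso-degrees : ∀ u → LassoDegree L u
  lasso-degrees u with u F.≟ p 0 | u F.≟ p (suc m) | deg-lasso u
  ... | yes e | yes f | _ = ⊥-elim (lasso-ends-distinct (trans (sym e) f))
  ... | yes e | no  _ | d = leaf e (ℕ.+-cancelʳ-≡ 1 _ _ d)
  ... | no  _ | yes f | d = branch f (trans (sym (ℕ.+-identityʳ _)) d)
  ... | no ¬e | no ¬f | d = inner ¬e ¬f (trans (sym (ℕ.+-identityʳ _)) d)

  lasso-deg-branch : deg G (p (suc m)) ≡ 3
  lasso-deg-branch with lasso-degrees (p (suc m))
  ... | leaf e _    = ⊥-elim (lasso-ends-distinct (sym e))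
  ... | branch _ d  = d
  ... | inner _ f _ = ⊥-elim (f refl)

module _ {ℓ m} {G H : Graph (suc ℓ)} (LG : IsLasso m G) (LH : IsLasso m H) where
  private
    module G = IsLasso LG
    module H = IsLasso LH

  lasso-iso : Iso G H
  lasso-iso = mk↔ₛ′ (λ v → H.p (G.index v)) (λ v → G.p (H.index v))
      (λ v → trans (cong H.p (G.index-p (H.index≤ℓ v))) (H.p-index v))
      (λ v → trans (cong G.p (H.index-p (G.index≤ℓ v))) (G.p-index v)) ,
    λ i j → ⇔→≡ {z = true} (mk⇔
      (λ e → subst₂ (λ x y → adj G x y ≡ true) (G.p-index i) (G.p-index j)
               (G.link⇒adj (G.index≤ℓ i) (G.index≤ℓ j) (H.adj⇒link (G.index≤ℓ i) (G.index≤ℓ j) e)))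
      (λ e → H.link⇒adj (G.index≤ℓ i) (G.index≤ℓ j) (G.adj⇒link′ e)))

lasso-transport : ∀ {ℓ m} {G H : Graph (suc ℓ)} → Iso G H → IsLasso m H → IsLasso m G
lasso-transport {G = G} {H} (f , hom) LH = record
  { gap      = gap
  ; p        = from ∘ p
  ; inj      = λ a< b< e → inj a< b< (trans (sym (to-from _)) (trans (cong to e) (to-from _)))
  ; index    = index ∘ to
  ; index≤ℓ  = index≤ℓ ∘ to
  ; p-index  = λ v → trans (cong from (p-index (to v))) (from-to v)
  ; link⇒adj = λ a≤ b≤ l → trans (back _ _) (link⇒adj a≤ b≤ l)
  ; adj⇒link = λ a≤ b≤ e → adj⇒link a≤ b≤ (trans (sym (back _ _)) e)
  }
  where
  open IsLasso LH
  open Inverse f using (to; from)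
  to-from : ∀ v → to (from v) ≡ v
  to-from = Inverse.strictlyInverseˡ f
  from-to : ∀ v → from (to v) ≡ v
  from-to = Inverse.strictlyInverseʳ f
  back : ∀ u v → adj G (from u) (from v) ≡ adj H u v
  back u v = trans (sym (hom (from u) (from v))) (cong₂ (adj H) (to-from u) (to-from v))

-- Every cycle of a lasso runs along its loop

LastEdge : {A : Set} → List A → A → A → Set
LastEdge []              a b = ⊥
LastEdge (x ∷ [])        a b = ⊥
LastEdge (x ∷ y ∷ [])    a b = a ≡ y × b ≡ x
LastEdge (x ∷ y ∷ z ∷ r) a b = LastEdge (y ∷ z ∷ r) a b

module _ {n : ℕ} where
  private V = Fin n

  -- In a path without repetition only the two end vertices lack a second incident edge; the first
  -- two alternatives are the edges leaving these ends.
  path-continues : ∀ (x y : V) r → Unique (x ∷ y ∷ r) → ∀ {u v} → InChain (x ∷ y ∷ r) u v →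
    (u ≡ x × v ≡ y) ⊎ LastEdge (x ∷ y ∷ r) u v ⊎ ∃ λ v′ → v′ ≢ v × InChain (x ∷ y ∷ r) u v′
  path-continues x y []      _ (inj₁ e)        = inj₁ e
  path-continues x y []      _ (inj₂ (inj₁ e)) = inj₂ (inj₁ e)
  path-continues x y (z ∷ r) _ (inj₁ e)        = inj₁ e
  path-continues x y (z ∷ r) ((_ ∷ x≢z ∷ _) ∷ _) (inj₂ (inj₁ (refl , refl))) =
    inj₂ (inj₂ (z , x≢z ∘ sym , inj₂ (inj₂ (inj₁ (refl , refl)))))
  path-continues x y (z ∷ r) ((_ ∷ x≢z ∷ _) ∷ uniq) (inj₂ (inj₂ i)) with path-continues y z r uniq i
  ... | inj₁ (refl , refl)           = inj₂ (inj₂ (x , x≢z , inj₂ (inj₁ (refl , refl))))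
  ... | inj₂ (inj₁ last)             = inj₂ (inj₁ last)
  ... | inj₂ (inj₂ (v′ , v′≢v , i′)) = inj₂ (inj₂ (v′ , v′≢v , inj₂ (inj₂ i′)))

  LastEdge-last : ∀ (ys : List V) {x a b} → LastEdge (ys ++ [ x ]) a b → a ≡ x
  LastEdge-last (y ∷ [])         (e , _) = e
  LastEdge-last (y ∷ z ∷ [])     l = LastEdge-last (z ∷ []) l
  LastEdge-last (y ∷ z ∷ w ∷ ys) l = LastEdge-last (z ∷ w ∷ ys) l

  ∃-LastEdge : ∀ y (ys : List V) x → ∃ λ b → LastEdge (y ∷ ys ++ [ x ]) x b
  ∃-LastEdge y []           x = y , refl , refl
  ∃-LastEdge y (z ∷ [])     x = ∃-LastEdge z [] x
  ∃-LastEdge y (z ∷ w ∷ ys) x = ∃-LastEdge z (w ∷ ys) x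

  LastEdge⇒InChain : ∀ (ys : List V) {a b} → LastEdge ys a b → InChain ys a b
  LastEdge⇒InChain (x ∷ y ∷ [])    e = inj₂ (inj₁ e)
  LastEdge⇒InChain (x ∷ y ∷ z ∷ r) l = inj₂ (inj₂ (LastEdge⇒InChain (y ∷ z ∷ r) l))

  LastEdge-∈ : ∀ y z (r : List V) {a b} → LastEdge (y ∷ z ∷ r) a b → b ∈ (y ∷ z ∷ r)
  LastEdge-∈ y z []      (_ , refl) = here refl
  LastEdge-∈ y z (w ∷ r) l          = there (LastEdge-∈ z w r l)

  -- Cut open at its first edge from x to y, the cycle becomes a path from `y` to `x` without
  -- repetition. Its inner vertices continue along the path, and its two ends continue along the
  -- edge that was cut.
  cycle-continues : ∀ (G : Graph n) c → IsCycle G c → ∀ {u v} → CycleEdge c u v →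
    ∃ λ v′ → v′ ≢ v × CycleEdge c u v′
  cycle-continues G (x ∷ [])          (s≤s () , _)
  cycle-continues G (x ∷ y ∷ [])      (s≤s (s≤s ()) , _)
  cycle-continues G (x ∷ y ∷ z ∷ r) (_ , (x≢y ∷ x≢z ∷ x∉r) ∷ uniq , _) = go
    where
    Loop : List V
    Loop = y ∷ z ∷ r ++ [ x ]
    uniqT : Unique Loop
    uniqT = Unique.++⁺ uniq ([] ∷ []) λ { (i , here refl) → All.lookup (x≢y ∷ x≢z ∷ x∉r) i refl }
    y∉ : ∀ {ys} → Unique (y ∷ ys) → ∀ {b} → b ∈ ys → b ≢ y
    y∉ (y∉ys ∷ _) i = All.lookup y∉ys i ∘ sym
    last≢y : ∀ r′ {a b} → Unique (y ∷ z ∷ r′ ++ [ x ]) → LastEdge (y ∷ z ∷ r′ ++ [ x ]) a b → b ≢ y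
    last≢y []       u l = y∉ u (LastEdge-∈ z x [] l)
    last≢y (w ∷ r′) u l = y∉ u (LastEdge-∈ z w (r′ ++ [ x ]) l)
    go : ∀ {u v} → InChain (x ∷ Loop) u v → ∃ λ v′ → v′ ≢ v × InChain (x ∷ Loop) u v′
    go (inj₁ (refl , refl)) = let b , l = ∃-LastEdge y (z ∷ r) x in
      b , last≢y r uniqT l , inj₂ (inj₂ (LastEdge⇒InChain Loop l))
    go (inj₂ (inj₁ (refl , refl))) = z , x≢z ∘ sym , inj₂ (inj₂ (inj₁ (refl , refl)))
    go (inj₂ (inj₂ i)) with path-continues y z (r ++ [ x ]) uniqT i
    ... | inj₁ (refl , refl) = x , x≢z , inj₂ (inj₁ (refl , refl))
    ... | inj₂ (inj₂ (v′ , v′≢v , i′)) = v′ , v′≢v , inj₂ (inj₂ i′)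
    ... | inj₂ (inj₁ l) with LastEdge-last (y ∷ z ∷ r) l
    ...   | refl = y , last≢y r uniqT l ∘ sym , inj₁ (refl , refl)

InChain-sym : ∀ {n} (c : List (Fin n)) {u v} → InChain c u v → InChain c v u
InChain-sym (x ∷ y ∷ c) (inj₁ (e , f))        = inj₂ (inj₁ (f , e))
InChain-sym (x ∷ y ∷ c) (inj₂ (inj₁ (e , f))) = inj₁ (f , e)
InChain-sym (x ∷ y ∷ c) (inj₂ (inj₂ i))       = inj₂ (inj₂ (InChain-sym (y ∷ c) i))

CycleEdge-sym : ∀ {n} (c : List (Fin n)) {u v} → CycleEdge c u v → CycleEdge c v u
CycleEdge-sym (x ∷ c) = InChain-sym (x ∷ c ++ [ x ])

∃-CycleEdge : ∀ {n} (G : Graph n) c → IsCycle G c → ∃₂ (CycleEdge c)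
∃-CycleEdge G (x ∷ [])    (s≤s () , _)
∃-CycleEdge G (x ∷ y ∷ r) _ = x , y , inj₁ (refl , refl)

-- An edge of a cycle continues along it, so on the lasso it cannot lie on the
-- tail (which would lead to the end vertex 0) and it propagates around the loop.
module _ {ℓ m} (G : Graph (suc ℓ)) (L : IsLasso m G) (c : List (Fin (suc ℓ))) (cyc : IsCycle G c) where
  open IsLasso L
  private
    E : ℕ → ℕ → Set
    E a b = CycleEdge c (p a) (p b)

    E-sym : ∀ {a b} → E a b → E b a
    E-sym = CycleEdge-sym c

    E-link : ∀ {a b} → a ≤ ℓ → b ≤ ℓ → E a b → Link m ℓ a b
    E-link a≤ b≤ e = adj⇒link a≤ b≤ (CycleEdge⇒adj G c cyc e)

    E-next : ∀ {a b} → E a b → ∃ λ d → d ≢ b × d ≤ ℓ × E a d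
    E-next {a} {b} e with cycle-continues G c cyc e
    ... | v , v≢ , e′ = index v , (λ i≡b → v≢ (trans (sym (p-index v)) (cong p i≡b))) , index≤ℓ v ,
      subst (CycleEdge c (p a)) (sym (p-index v)) e′

    m<ℓ : m < ℓ
    m<ℓ = ℕ.<-≤-trans (ℕ.≤-reflexive (sym (ℕ.+-comm m 1))) (ℕ.≤-trans (ℕ.+-monoʳ-≤ m (s≤s z≤n)) gap)

    no-tail : ∀ {t} → t < m → ¬ E t (suc t)
    no-tail {t} t<m e with E-next e
    ... | d , d≢ , d≤ , e′ with E-link (ℕ.<⇒≤ (ℕ.<-trans t<m m<ℓ)) d≤ e′
    ...   | up     = d≢ refl
    ...   | down   = no-tail (ℕ.<⇒≤ t<m) (E-sym e′)
    ...   | close  = ℕ.<-irrefl refl t<m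
    ...   | reopen = ℕ.<-asym t<m m<ℓ

    on-loop : ∀ {a b} → a ≤ ℓ → b ≤ ℓ → E a b → m ≤ a
    on-loop a≤ b≤ e with E-link a≤ b≤ e
    ... | up     = ℕ.≮⇒≥ λ a<m → no-tail a<m e
    ... | down   = ℕ.≮⇒≥ λ a<m → no-tail (ℕ.<⇒≤ a<m) (E-sym e)
    ... | close  = ℕ.≤-refl
    ... | reopen = m≤ℓ

    E-up : ∀ {t} → m ≤ t → suc t < ℓ → E t (suc t) → E (suc t) (suc (suc t))
    E-up m≤t t<ℓ e with E-next (E-sym e)
    ... | d , d≢ , d≤ , e′ with E-link (ℕ.<⇒≤ t<ℓ) d≤ e′
    ...   | up     = e′
    ...   | down   = ⊥-elim (d≢ refl)
    ...   | close  = ⊥-elim (ℕ.<-irrefl refl m≤t)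
    ...   | reopen = ⊥-elim (ℕ.<-irrefl refl t<ℓ)

    E-close : ∀ {t} → suc t ≡ ℓ → m ≤ t → E t ℓ → E ℓ m
    E-close refl m≤t e with E-next (E-sym e)
    ... | d , d≢ , d≤ , e′ with E-link ℕ.≤-refl d≤ e′
    ...   | up     = ⊥-elim (ℕ.<-irrefl refl d≤)
    ...   | down   = ⊥-elim (d≢ refl)
    ...   | close  = ⊥-elim (ℕ.<-irrefl refl m≤t)
    ...   | reopen = e′

    E-restart : E ℓ m → E m (suc m)
    E-restart e with E-next (E-sym e)
    ... | d , d≢ , d≤ , e′ with E-link m≤ℓ d≤ e′
    ...   | up     = e′
    ...   | down   = ⊥-elim (ℕ.<-irrefl refl (on-loop d≤ m≤ℓ (E-sym e′)))
    ...   | close  = ⊥-elim (d≢ refl)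
    ...   | reopen = ⊥-elim (ℕ.<-irrefl refl m<ℓ)

    E-climb : ∀ s {t} → t ≡ s + m → t < ℓ → E m (suc m) → E t (suc t)
    E-climb zero    refl t<ℓ e = e
    E-climb (suc s) refl t<ℓ e = E-up (ℕ.m≤n+m m s) t<ℓ (E-climb s refl (ℕ.<⇒≤ t<ℓ) e)

    -- The number `s` of steps still missing to the end of the loop decreases while the edge itself
    -- moves upwards; at the end the closing link leads back to `m`.
    E-descend : ∀ s {t} → suc (s + t) ≡ ℓ → m ≤ t → E t (suc t) → E m (suc m)
    E-descend zero    refl m≤t e = E-restart (E-close refl m≤t e)
    E-descend (suc s) {t} eq   m≤t e = E-descend s (trans (cong suc (ℕ.+-suc s t)) eq) (ℕ.m≤n⇒m≤1+n m≤t)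
      (E-up m≤t (subst (suc t <_) eq (s≤s (s≤s (ℕ.m≤n+m t s)))) e)

    E-from-up : ∀ {t} → m ≤ t → t < ℓ → E t (suc t) → E m (suc m)
    E-from-up {t} m≤t t<ℓ = E-descend (ℓ ∸ suc t) (trans (sym (ℕ.+-suc (ℓ ∸ suc t) t)) (ℕ.m∸n+n≡m t<ℓ)) m≤t

    E-base : E m (suc m)
    E-base with ∃-CycleEdge G c cyc
    ... | u , v , uv = from (index≤ℓ u) (index≤ℓ v) (subst₂ (CycleEdge c) (sym (p-index u)) (sym (p-index v)) uv)
      where
      from : ∀ {a b} → a ≤ ℓ → b ≤ ℓ → E a b → E m (suc m)
      from a≤ b≤ e with E-link a≤ b≤ e
      ... | up     = E-from-up (on-loop a≤ b≤ e) b≤ e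
      ... | down   = E-from-up (on-loop b≤ a≤ (E-sym e)) a≤ (E-sym e)
      ... | close  = E-restart (E-sym e)
      ... | reopen = E-restart e

    E-step : ∀ {t} → m ≤ t → t < ℓ → E t (suc t)
    E-step {t} m≤t t<ℓ = E-climb (t ∸ m) (sym (ℕ.m∸n+n≡m m≤t)) t<ℓ E-base

    E-wrap : ∀ {l} → l ≡ ℓ → E l m
    E-wrap {zero}  refl = ⊥-elim (ℕ.<⇒≱ m<ℓ z≤n)
    E-wrap {suc l} refl = E-close refl (ℕ.≤-pred m<ℓ) (E-step (ℕ.≤-pred m<ℓ) ℕ.≤-refl)

    E-loop : ∀ {a b} → a ≤ ℓ → b ≤ ℓ → m ≤ a → m ≤ b → Link m ℓ a b → E a b
    E-loop a≤ b≤ m≤a m≤b up     = E-step m≤a b≤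
    E-loop a≤ b≤ m≤a m≤b down   = E-sym (E-step m≤b a≤)
    E-loop a≤ b≤ m≤a m≤b close  = E-sym (E-wrap refl)
    E-loop a≤ b≤ m≤a m≤b reopen = E-wrap refl

  LoopEdge : Fin (suc ℓ) → Fin (suc ℓ) → Set
  LoopEdge u v = Link m ℓ (index u) (index v) × m ≤ index u × m ≤ index v

  CycleEdge⇒LoopEdge : ∀ {u v} → CycleEdge c u v → LoopEdge u v
  CycleEdge⇒LoopEdge {u} {v} uv = E-link u≤ v≤ e , on-loop u≤ v≤ e , on-loop v≤ u≤ (E-sym e)
    where
    u≤ = index≤ℓ u
    v≤ = index≤ℓ v
    e : E (index u) (index v)
    e = subst₂ (CycleEdge c) (sym (p-index u)) (sym (p-index v)) uv

  LoopEdge⇒CycleEdge : ∀ {u v} → LoopEdge u v → CycleEdge c u v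
  LoopEdge⇒CycleEdge {u} {v} (l , m≤u , m≤v) = subst₂ (CycleEdge c) (p-index u) (p-index v)
    (E-loop (index≤ℓ u) (index≤ℓ v) m≤u m≤v l)

-- The degree sum 2n forces some cycle. Uniqueness holds because `LoopEdge` is determined by the
-- labelling alone, so the edge sets of any two cycles both coincide with it.
lasso-unicyclic : ∀ {ℓ m} (G : Graph (suc ℓ)) → IsLasso m G → Unicyclic G
lasso-unicyclic {ℓ} G L with ∃-cycle ℓ G (ℕ.m≤n⇒m≤1+n (ℕ.≤-reflexive (sym (marked⇒volume G (IsLasso.deg-lasso L)))))
... | c , cyc = IsLasso.connected L , c , cyc , λ d cyc-d u v →
  (λ e → LoopEdge⇒CycleEdge G L d cyc-d (CycleEdge⇒LoopEdge G L c cyc e)) ,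
  (λ e → LoopEdge⇒CycleEdge G L c cyc (CycleEdge⇒LoopEdge G L d cyc-d e))

-- Lollipops are lassos

data Arc (k : ℕ) : ℕ → ℕ → Set where
  around  : ∀ {x} → suc x < k → Arc k x (suc x)
  tail    : ∀ {x} → k ≤ x → Arc k x (suc x)
  closing : ∀ {x} → suc x ≡ k → Arc k 0 x
  attach  : Arc k 0 k

Arc⇒lolE : ∀ {k x y} → Arc k x y → lolE k x y ≡ true
Arc⇒lolE a = Equivalence.to T-≡ (go a)
  where
  ∨ˡ : ∀ {x y} → T x → T (x ∨ y)
  ∨ˡ = Equivalence.from T-∨ ∘ inj₁
  ∨ʳ : ∀ {x y} → T y → T (x ∨ y)
  ∨ʳ {x} = Equivalence.from (T-∨ {x}) ∘ inj₂
  _&_ : ∀ {x y} → T x → T y → T (x ∧ y)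
  s & t = Equivalence.from T-∧ (s , t)
  eq : ∀ n → T (n ℕ.≡ᵇ n)
  eq n = ℕ.≡⇒≡ᵇ n n refl
  go : ∀ {k x y} → Arc k x y → T (lolE k x y)
  go {k} {x} (around x<k) = ∨ˡ (eq x & ∨ˡ (ℕ.<⇒<ᵇ x<k))
  go {k} {x} (tail k≤x) with ℕ.m≤n⇒m<n∨m≡n k≤x
  ... | inj₁ k<x  = ∨ˡ (eq x & ∨ʳ {suc x ℕ.<ᵇ k} (∨ʳ {x ℕ.≡ᵇ k} (ℕ.<⇒<ᵇ k<x)))
  ... | inj₂ refl = ∨ˡ (eq x & ∨ʳ {suc x ℕ.<ᵇ k} (∨ˡ (eq x)))
  go {y = y} (closing refl) = ∨ʳ {(y ℕ.≡ᵇ 1) ∧ _} (∨ˡ (eq y))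
  go {k} attach = ∨ʳ {(k ℕ.≡ᵇ 1) ∧ _} (∨ʳ {k ℕ.≡ᵇ (k ∸ 1)} (eq k))

lolE⇒Arc : ∀ {k x y} → 0 < k → lolE k x y ≡ true → Arc k x y
lolE⇒Arc {suc l} {x} {y} _ e with Equivalence.to (T-∨ {(y ℕ.≡ᵇ suc x) ∧ _}) (Equivalence.from T-≡ e)
... | inj₂ t with Equivalence.to (T-∨ {(x ℕ.≡ᵇ 0) ∧ (y ℕ.≡ᵇ l)}) t
...   | inj₁ t′ = let a , b = Equivalence.to (T-∧ {x ℕ.≡ᵇ 0}) t′ in
  subst (λ z → Arc (suc l) z y) (sym (ℕ.≡ᵇ⇒≡ x 0 a)) (closing (cong suc (ℕ.≡ᵇ⇒≡ y l b)))
...   | inj₂ t′ = let a , b = Equivalence.to (T-∧ {x ℕ.≡ᵇ 0}) t′ in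
  subst₂ (Arc (suc l)) (sym (ℕ.≡ᵇ⇒≡ x 0 a)) (sym (ℕ.≡ᵇ⇒≡ y (suc l) b)) attach
lolE⇒Arc {k@(suc l)} {x} {y} _ e | inj₁ t with Equivalence.to (T-∧ {y ℕ.≡ᵇ suc x}) t
... | a , b with ℕ.≡ᵇ⇒≡ y (suc x) a | Equivalence.to (T-∨ {y ℕ.<ᵇ k}) b
...   | refl | inj₁ lt = around (ℕ.<ᵇ⇒< y k lt)
...   | refl | inj₂ t′ with Equivalence.to (T-∨ {x ℕ.≡ᵇ k}) t′
...     | inj₁ eq = tail (ℕ.≤-reflexive (sym (ℕ.≡ᵇ⇒≡ x k eq)))
...     | inj₂ lt = tail (ℕ.<⇒≤ (ℕ.<ᵇ⇒< k x lt))

Arc⇒≢ : ∀ {k x y} → 2 ≤ k → Arc k x y → x ≢ y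
Arc⇒≢ (s≤s ()) (closing refl) refl

module _ {ℓ k : ℕ} (3≤k : 3 ≤ k) (k≤n : k ≤ suc ℓ) where
  private
    m : ℕ
    m = suc ℓ ∸ k

    m+k : m + k ≡ suc ℓ
    m+k = ℕ.m∸n+n≡m k≤n

    gap : m + 2 ≤ ℓ
    gap = ℕ.≤-pred (begin
      suc (m + 2) ≡⟨ ℕ.+-suc m 2 ⟨
      m + 3       ≤⟨ ℕ.+-monoʳ-≤ m 3≤k ⟩
      m + k       ≡⟨ m+k ⟩
      suc ℓ       ∎)
      where open ℕ.≤-Reasoning

    m≤ℓ : m ≤ ℓ
    m≤ℓ = ℕ.≤-trans (ℕ.m≤m+n m 2) gap

    0<k : 0 < k
    0<k = ℕ.≤-trans (s≤s z≤n) 3≤k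

    below : ∀ {a} → a < m → k ≤ ℓ ∸ a
    below {a} a<m = ℕ.m+n≤o⇒m≤o∸n k (ℕ.≤-pred (subst₂ _≤_ (ℕ.+-suc k a) (trans (ℕ.+-comm k m) m+k) (ℕ.+-monoʳ-≤ k a<m)))

    -- A lasso is labelled from the leaf inwards, a lollipop from the branch vertex around the cycle
    -- and then outwards. So tail places are reversed and loop places are shifted by `m`; `ψ` goes
    -- back.
    φ : ℕ → ℕ
    φ a with a ℕ.<? m
    ... | yes _ = ℓ ∸ a
    ... | no  _ = a ∸ m

    φ-tail : ∀ {a} → a < m → φ a ≡ ℓ ∸ a
    φ-tail {a} a<m with a ℕ.<? m
    ... | yes _ = refl
    ... | no ¬p = ⊥-elim (¬p a<m)

    φ-loop : ∀ {a} → m ≤ a → φ a ≡ a ∸ m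
    φ-loop {a} m≤a with a ℕ.<? m
    ... | yes p = ⊥-elim (ℕ.<⇒≱ p m≤a)
    ... | no _  = refl

    φ≤ℓ : ∀ {a} → a ≤ ℓ → φ a ≤ ℓ
    φ≤ℓ {a} a≤ℓ with a ℕ.<? m
    ... | yes _ = ℕ.m∸n≤m ℓ a
    ... | no  _ = ℕ.≤-trans (ℕ.m∸n≤m a m) a≤ℓ

    ψ : ℕ → ℕ
    ψ x with x ℕ.<? k
    ... | yes _ = x + m
    ... | no  _ = ℓ ∸ x

    ψ-loop : ∀ {x} → x < k → ψ x ≡ x + m
    ψ-loop {x} x<k with x ℕ.<? k
    ... | yes _ = refl
    ... | no ¬p = ⊥-elim (¬p x<k)

    ψ-tail : ∀ {x} → k ≤ x → ψ x ≡ ℓ ∸ x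
    ψ-tail {x} k≤x with x ℕ.<? k
    ... | yes p = ⊥-elim (ℕ.<⇒≱ p k≤x)
    ... | no _  = refl

    ψ≤ℓ : ∀ x → ψ x ≤ ℓ
    ψ≤ℓ x with x ℕ.<? k
    ... | yes x<k = ℕ.≤-pred (subst (suc x + m ≤_) (trans (ℕ.+-comm k m) m+k) (ℕ.+-monoˡ-≤ m x<k))
    ... | no  _   = ℕ.m∸n≤m ℓ x

    loop< : ∀ {a} → a ≤ ℓ → m ≤ a → a ∸ m < k
    loop< {a} a≤ℓ m≤a = ℕ.+-cancelʳ-< m _ _ (begin-strict
      a ∸ m + m ≡⟨ ℕ.m∸n+n≡m m≤a ⟩
      a         <⟨ s≤s a≤ℓ ⟩
      suc ℓ     ≡⟨ trans (ℕ.+-comm k m) m+k ⟨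
      k + m     ∎)
      where open ℕ.≤-Reasoning

    ψ-φ : ∀ {a} → a ≤ ℓ → ψ (φ a) ≡ a
    ψ-φ {a} a≤ℓ with a ℕ.<? m
    ... | yes a<m = trans (ψ-tail (below a<m)) (ℕ.m∸[m∸n]≡n a≤ℓ)
    ... | no  a≮m = trans (ψ-loop (loop< a≤ℓ m≤a)) (ℕ.m∸n+n≡m m≤a)
      where m≤a = ℕ.≮⇒≥ a≮m

    φ-ψ : ∀ {x} → x ≤ ℓ → φ (ψ x) ≡ x
    φ-ψ {x} x≤ℓ with x ℕ.<? k
    ... | yes x<k = trans (φ-loop (ℕ.m≤n+m m x)) (ℕ.m+n∸n≡m x m)
    ... | no  x≮k = trans (φ-tail tail<) (ℕ.m∸[m∸n]≡n x≤ℓ)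
      where
      tail< : ℓ ∸ x < m
      tail< = subst (_≤ m) (ℕ.+-∸-assoc 1 x≤ℓ) (ℕ.∸-monoʳ-≤ (suc ℓ) (ℕ.≮⇒≥ x≮k))

    pred∸ : ∀ {x} → suc x ≤ ℓ → ℓ ∸ x ≡ suc (ℓ ∸ suc x)
    pred∸ x<ℓ = ℕ.+-∸-assoc 1 x<ℓ

    Arc⇒Link : ∀ {x y} → y ≤ ℓ → Arc k x y → Link m ℓ (ψ x) (ψ y)
    Arc⇒Link {x} _ (around sx<k) = subst₂ (Link m ℓ)
      (sym (ψ-loop (ℕ.<-trans (ℕ.n<1+n x) sx<k))) (sym (ψ-loop sx<k)) up
    Arc⇒Link {x} y≤ℓ (tail k≤x) = subst₂ (Link m ℓ)
      (sym (trans (ψ-tail k≤x) (pred∸ y≤ℓ))) (sym (ψ-tail (ℕ.m≤n⇒m≤1+n k≤x))) down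
    Arc⇒Link {y = y} _ (closing sy≡k) = subst₂ (Link m ℓ)
      (sym (ψ-loop 0<k)) (sym (trans (ψ-loop (ℕ.≤-reflexive sy≡k)) y+m≡ℓ)) close
      where
      y+m≡ℓ : y + m ≡ ℓ
      y+m≡ℓ = ℕ.suc-injective (trans (cong (_+ m) sy≡k) (trans (ℕ.+-comm k m) m+k))
    Arc⇒Link k≤ℓ attach = subst₂ (Link m ℓ)
      (sym (trans (ψ-loop 0<k) (ℕ.+-∸-assoc 1 k≤ℓ))) (sym (ψ-tail ℕ.≤-refl)) down

    up⇒Arc : ∀ {a} → suc a ≤ ℓ → Arc k (φ a) (φ (suc a)) ⊎ Arc k (φ (suc a)) (φ a)
    up⇒Arc {a} a<ℓ with ℕ.<-cmp (suc a) m
    ... | tri< sa<m _ _ = inj₂ (subst₂ (Arc k) (sym (φ-tail sa<m))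
      (sym (trans (φ-tail (ℕ.<-trans (ℕ.n<1+n a) sa<m)) (pred∸ a<ℓ))) (tail (below sa<m)))
    ... | tri≈ _ sa≡m _ = inj₂ (subst₂ (Arc k)
      (sym (trans (φ-loop (ℕ.≤-reflexive (sym sa≡m))) (trans (cong (suc a ∸_) (sym sa≡m)) (ℕ.n∸n≡0 (suc a)))))
      (sym (trans (φ-tail (ℕ.≤-reflexive sa≡m)) (trans (cong (_∸ a) ℓ≡) (ℕ.m+n∸m≡n a k)))) attach)
      where
      ℓ≡ : ℓ ≡ a + k
      ℓ≡ = ℕ.suc-injective (trans (sym m+k) (cong (_+ k) (sym sa≡m)))
    ... | tri> _ _ (s≤s m≤a) = inj₁ (subst₂ (Arc k) (sym (φ-loop m≤a))
      (sym (trans (φ-loop (ℕ.m≤n⇒m≤1+n m≤a)) (ℕ.+-∸-assoc 1 m≤a)))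
      (around (subst (_< k) (ℕ.+-∸-assoc 1 m≤a) (loop< a<ℓ (ℕ.m≤n⇒m≤1+n m≤a)))))

    close⇒Arc : Arc k (φ m) (φ ℓ)
    close⇒Arc = subst₂ (Arc k) (sym (trans (φ-loop ℕ.≤-refl) (ℕ.n∸n≡0 m))) (sym (φ-loop m≤ℓ))
      (closing (trans (sym (ℕ.+-∸-assoc 1 m≤ℓ)) (trans (cong (_∸ m) (sym m+k)) (ℕ.m+n∸m≡n m k))))

    Link⇒Arc : ∀ {a b} → a ≤ ℓ → b ≤ ℓ → Link m ℓ a b → Arc k (φ a) (φ b) ⊎ Arc k (φ b) (φ a)
    Link⇒Arc a≤ b≤ up     = up⇒Arc b≤
    Link⇒Arc a≤ b≤ down   = swap (up⇒Arc a≤)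
    Link⇒Arc a≤ b≤ close  = inj₁ close⇒Arc
    Link⇒Arc a≤ b≤ reopen = inj₂ close⇒Arc

    -- Taking the minimum with `ℓ` makes `p` total; it changes nothing at places up to `ℓ`.
    p : ℕ → Fin (suc ℓ)
    p a = F.fromℕ< (s≤s (ℕ.m⊓n≤n (φ a) ℓ))

    toℕ-p : ∀ {a} → a ≤ ℓ → toℕ (p a) ≡ φ a
    toℕ-p {a} a≤ℓ = trans (F.toℕ-fromℕ< (s≤s (ℕ.m⊓n≤n (φ a) ℓ))) (ℕ.m≤n⇒m⊓n≡m (φ≤ℓ a≤ℓ))

    adj⇒Arc : ∀ i j → adj (lollipop (suc ℓ) k) i j ≡ true → Arc k (toℕ i) (toℕ j) ⊎ Arc k (toℕ j) (toℕ i)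
    adj⇒Arc i j e with lolE k (toℕ i) (toℕ j) in eᵢⱼ
    ... | true = inj₁ (lolE⇒Arc 0<k eᵢⱼ)
    ... | false with lolE k (toℕ j) (toℕ i) in eⱼᵢ
    ...   | true = inj₂ (lolE⇒Arc 0<k eⱼᵢ)
    adj⇒Arc i j () | false | false

    Arc⇒adj : ∀ i j → Arc k (toℕ i) (toℕ j) ⊎ Arc k (toℕ j) (toℕ i) → adj (lollipop (suc ℓ) k) i j ≡ true
    Arc⇒adj i j (inj₁ a) rewrite Arc⇒lolE a
      | dec-false (toℕ i ℕ.≟ toℕ j) (Arc⇒≢ (ℕ.<⇒≤ 3≤k) a) = refl
    Arc⇒adj i j (inj₂ a) = trans (Graph.sym (lollipop (suc ℓ) k) i j) (Arc⇒adj j i (inj₁ a))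

  lollipop-lasso : IsLasso m (lollipop (suc ℓ) k)
  lollipop-lasso = record
    { gap      = gap
    ; p        = p
    ; inj      = λ { {a} {b} (s≤s a≤) (s≤s b≤) e → trans (sym (ψ-φ a≤))
                   (trans (cong ψ (trans (sym (toℕ-p a≤)) (trans (cong toℕ e) (toℕ-p b≤)))) (ψ-φ b≤)) }
    ; index    = ψ ∘ toℕ
    ; index≤ℓ  = ψ≤ℓ ∘ toℕ
    ; p-index  = λ v → F.toℕ-injective (trans (toℕ-p (ψ≤ℓ (toℕ v))) (φ-ψ (F.toℕ≤pred[n] v)))
    ; link⇒adj = λ {a} {b} a≤ b≤ l → Arc⇒adj (p a) (p b)
        (subst₂ (λ x y → Arc k x y ⊎ Arc k y x) (sym (toℕ-p a≤)) (sym (toℕ-p b≤)) (Link⇒Arc a≤ b≤ l))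
    ; adj⇒link = λ {a} {b} a≤ b≤ e → subst₂ (Link m ℓ)
        (trans (cong ψ (toℕ-p a≤)) (ψ-φ a≤)) (trans (cong ψ (toℕ-p b≤)) (ψ-φ b≤)) (arc⇒link (p a) (p b) (adj⇒Arc (p a) (p b) e))
    }
    where
    arc⇒link : ∀ i j → Arc k (toℕ i) (toℕ j) ⊎ Arc k (toℕ j) (toℕ i) → Link m ℓ (ψ (toℕ i)) (ψ (toℕ j))
    arc⇒link i j (inj₁ a) = Arc⇒Link (F.toℕ≤pred[n] j) a
    arc⇒link i j (inj₂ a) = Link-sym (Arc⇒Link (F.toℕ≤pred[n] i) a)

-- Recognising a lasso by its degrees

-- Walk from w without backtracking up to the first repeated vertex.  The degrees
-- force this vertex to be v, and the visited vertices to have no other neighbours.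
module _ {ℓ} (G : Graph (suc ℓ)) (conn : Connected G) {v w : Fin (suc ℓ)}
  (D : ∀ u → deg G u + pick (does (u F.≟ w)) 1 ≡ 2 + pick (does (u F.≟ v)) 1) where
  private
    2≤deg : ∀ {u} → u ≢ w → 2 ≤ deg G u
    2≤deg {u} u≢w = subst (2 ≤_) (trans (sym (D u))
      (trans (cong (λ b → deg G u + pick b 1) (dec-false (u F.≟ w) u≢w)) (ℕ.+-identityʳ _))) (ℕ.m≤m+n 2 _)

    pick≤1 : ∀ b → pick b 1 ≤ 1
    pick≤1 true  = ℕ.≤-refl
    pick≤1 false = z≤n

    1≤deg : 1 ≤ deg G w
    1≤deg = ℕ.+-cancelʳ-≤ 1 1 (deg G w) (ℕ.≤-trans (ℕ.≤-trans (ℕ.m≤m+n 2 _) (ℕ.≤-reflexive (sym (D w))))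
      (ℕ.+-monoʳ-≤ (deg G w) (pick≤1 (does (w F.≟ w)))))

    ww′ : adj G w (proj₁ (new-neighbour G w [] 1≤deg)) ≡ true
    ww′ = proj₂ (proj₂ (new-neighbour G w [] 1≤deg))

    open Walk G ww′ using (walk-nonBacktracking) renaming (walk to p)
    edge : ∀ i → adj G (p i) (p (suc i)) ≡ true
    edge = follows walk-nonBacktracking

    build : ∀ i ℓ′ → i < suc ℓ′ → p i ≡ p (suc ℓ′) → InjectiveBelow p (suc ℓ′) →
      ∃ λ m → Σ (IsLasso m G) λ L → IsLasso.p L 0 ≡ w × IsLasso.p L m ≡ v
    build i ℓ′ i<j back inj = i , L′ ℓ′≡ℓ , refl′ ℓ′≡ℓ , refl″ ℓ′≡ℓ
      where
      away : ∀ {a} → a ≤ ℓ′ → ∀ b → b ≤ ℓ′ → does (p a F.≟ p b) ≡ does (a ℕ.≟ b)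
      away {a} a≤ b b≤ = does-⇔ (mk⇔ (inj (s≤s a≤) (s≤s b≤)) (cong p)) (p a F.≟ p b) (a ℕ.≟ b)

      i<ℓ′ : i < ℓ′
      i<ℓ′ with ℕ.m≤n⇒m<n∨m≡n i<j
      ... | inj₁ si<j = ℕ.≤-pred si<j
      ... | inj₂ refl = ⊥-elim (adj-≢ G (edge i) back)

      -- To exclude a return after two steps, `p (suc i)` must have degree at least 2. Only `w`,
      -- which is `p 0`, can have a smaller degree, and injectivity keeps `p (suc i)` away from it.
      gap : i + 2 ≤ ℓ′
      gap = ℕ.≤-pred (begin
        suc (i + 2)              ≡⟨ ℕ.+-comm (suc i) 2 ⟩
        3 + i                    ≤⟨ ℕ.+-monoˡ-≤ i (repeat-gap G walk-nonBacktracking i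
                                      (2≤deg λ e → ℕ.1+n≢0 (inj (s≤s i<ℓ′) (s≤s z≤n) e))
                                      (ℕ.m<n⇒0<n∸m i<j) (trans back (cong p (sym (ℕ.m∸n+n≡m (ℕ.<⇒≤ i<j)))))) ⟩
        suc ℓ′ ∸ i + i           ≡⟨ ℕ.m∸n+n≡m (ℕ.<⇒≤ i<j) ⟩
        suc ℓ′                   ∎)
        where open ℕ.≤-Reasoning

      link⇒adj : ∀ {a b} → Link i ℓ′ a b → adj G (p a) (p b) ≡ true
      link⇒adj {a} up       = edge a
      link⇒adj {b = b} down = trans (Graph.sym G (p (suc b)) (p b)) (edge b)
      link⇒adj reopen = subst (λ z → adj G (p ℓ′) z ≡ true) (sym back) (edge ℓ′)
      link⇒adj close  = trans (Graph.sym G (p i) (p ℓ′)) (link⇒adj reopen)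

      module _ {a} (a≤ : a ≤ ℓ′) where
        open Linked (linked gap a a≤)

        known : List (Fin (suc ℓ))
        known = map p list

        known-unique : Unique known
        known-unique = Unique-map p inj (All.map (s≤s ∘ proj₂) sound) unique

        known-adj : All (λ z → adj G (p a) z ≡ true) known
        known-adj = map⁺ (All.map (link⇒adj ∘ proj₁) sound)

        size′ : length known + pick (does (p a F.≟ w)) 1 ≡ 2 + pick (does (a ℕ.≟ i)) 1
        size′ = trans (cong₂ _+_ (length-map p list) (cong (λ b → pick b 1) (away a≤ 0 z≤n))) size

      i≤ : i ≤ ℓ′
      i≤ = ℕ.<⇒≤ i<ℓ′

      -- At the closing vertex the known neighbours and the mark of `w` already count 3, whereas `D`
      -- allows only 2 for a vertex other than `v`.
      pi≡v : p i ≡ v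
      pi≡v with p i F.≟ v | D (p i)
      ... | yes e | _ = e
      ... | no  _ | d = ⊥-elim (ℕ.<⇒≱ ℕ.≤-refl (begin
        3                                                    ≡⟨ cong (λ b → 2 + pick b 1) (dec-true (i ℕ.≟ i) refl) ⟨
        2 + pick (does (i ℕ.≟ i)) 1                          ≡⟨ size′ i≤ ⟨
        length (known i≤) + pick (does (p i F.≟ w)) 1        ≤⟨ ℕ.+-monoˡ-≤ _ (length≤deg G (p i) (known-unique i≤) (known-adj i≤)) ⟩
        deg G (p i) + pick (does (p i F.≟ w)) 1              ≡⟨ d ⟩
        2                                                    ∎))
        where open ℕ.≤-Reasoning

      deg≡ : ∀ {a} (a≤ : a ≤ ℓ′) → deg G (p a) ≡ length (known a≤)
      deg≡ {a} a≤ = ℕ.+-cancelʳ-≡ (pick (does (p a F.≟ w)) 1) _ _ (trans (D (p a))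
        (trans (cong (λ b → 2 + pick b 1) (trans (cong (λ z → does (p a F.≟ z)) (sym pi≡v)) (away a≤ i i≤))) (sym (size′ a≤))))

      -- The prescribed degrees are used up by the known neighbours, so no edge leaves the visited
      -- set. Connectedness then makes the walk visit everything.
      closed : ∀ {a} → a ≤ ℓ′ → ∀ {z} → adj G (p a) z ≡ true → ∃ λ b → b ≤ ℓ′ × z ≡ p b × Link i ℓ′ a b
      closed {a} a≤ az =
        let b , b∈ , z≡ = ∈-map⁻ p (neighbours-exhausted G (p a) (known-unique a≤) (known-adj a≤) (ℕ.≤-reflexive (deg≡ a≤)) az)
            l , b≤      = All.lookup (Linked.sound (linked gap a a≤)) b∈
        in b , b≤ , z≡ , l

      visits : ∀ {a u z} → a ≤ ℓ′ → u ≡ p a → Reach G u z → ∃ λ b → b ≤ ℓ′ × p b ≡ z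
      visits {a} a≤ e here = a , a≤ , sym e
      visits a≤ refl (step d r) = let b , b≤ , z≡ , _ = closed a≤ d in visits b≤ z≡ r

      index : ∀ z → ∃ λ b → b ≤ ℓ′ × p b ≡ z
      index z = visits z≤n refl (conn (p 0) z)

      ℓ′≡ℓ : ℓ′ ≡ ℓ
      ℓ′≡ℓ = ℕ.suc-injective (ℕ.≤-antisym (injectiveBelow⇒≤ p inj) (F.injective⇒≤ {f = position} position-injective))
        where
        position : Fin (suc ℓ) → Fin (suc ℓ′)
        position z = F.fromℕ< (s≤s (proj₁ (proj₂ (index z))))
        toℕ-position : ∀ z → toℕ (position z) ≡ proj₁ (index z)
        toℕ-position z = F.toℕ-fromℕ< (s≤s (proj₁ (proj₂ (index z))))
        position-injective : ∀ {x y} → position x ≡ position y → x ≡ y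
        position-injective {x} {y} e = trans (sym (proj₂ (proj₂ (index x))))
          (trans (cong p (trans (sym (toℕ-position x)) (trans (cong toℕ e) (toℕ-position y)))) (proj₂ (proj₂ (index y))))

      L′ : ℓ′ ≡ ℓ → IsLasso i G
      L′ refl = record
        { gap      = gap
        ; p        = p
        ; inj      = inj
        ; index    = λ z → proj₁ (index z)
        ; index≤ℓ  = λ z → proj₁ (proj₂ (index z))
        ; p-index  = λ z → proj₂ (proj₂ (index z))
        ; link⇒adj = λ _ _ → link⇒adj
        ; adj⇒link = λ {a} a≤ b≤ e → let c , c≤ , eq , l = closed a≤ e in
            subst (Link i ℓ′ a) (inj (s≤s c≤) (s≤s b≤) (sym eq)) l
        }
      refl′ : (e : ℓ′ ≡ ℓ) → IsLasso.p (L′ e) 0 ≡ w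
      refl′ refl = refl
      refl″ : (e : ℓ′ ≡ ℓ) → IsLasso.p (L′ e) i ≡ v
      refl″ refl = pi≡v

  marked-lasso : ∃ λ m → Σ (IsLasso m G) λ L → IsLasso.p L 0 ≡ w × IsLasso.p L m ≡ v
  marked-lasso with first-repeat p
  ... | i , suc ℓ′ , i<j , back , inj = build i ℓ′ i<j back inj

-- Bounding the sum-connectivity index

-- Rational bounds for 1/√k in units of 1/12000.

-- n/2 in units of 1/12000; abstract because conversion checking would unfold it in unary.
abstract
  halves : ℕ → ℕ
  halves n = n * 6000

  halves-def : ∀ n → halves n ≡ n * 6000
  halves-def n = refl

upper : ℕ → ℕ
upper 0  = 12000
upper 1  = 12000
upper 2  = 8486
upper 3  = 6929
upper 4  = 6000
upper 5  = 5367
upper 6  = 4899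
upper 7  = 4536
upper 8  = 4243
upper 9  = 4000
upper 10 = 3795
upper 11 = 3619
upper _  = 3465

-- Lower bounds are evaluated only on the larger side of a comparison, where 3, 4 and 5 are the only
-- `k` that occur; 0 is valid for every other `k`.
lower : ℕ → ℕ
lower 3 = 6928
lower 4 = 6000
lower 5 = 5366
lower _ = 0

-- Reduces a check to finitely many closed cases and the tail `m + o`, on which functions with a
-- default clause compute even though `o` is a variable.
data SmallOrLarge (m : ℕ) : ℕ → Set where
  small : (i : Fin m) → SmallOrLarge m (toℕ i)
  large : ∀ o → SmallOrLarge m (m + o)

small-or-large : ∀ m k → SmallOrLarge m k
small-or-large zero    k       = large k
small-or-large (suc m) zero    = small zero
small-or-large (suc m) (suc k) with small-or-large m k
... | small i = small (suc i)
... | large o = large o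

UpperValid : ℕ → Set
UpperValid k = 1 ≤ k → 12000 * 12000 ≤ upper k * upper k * k

upper-valid : ∀ k → UpperValid k
upper-valid k with small-or-large 12 k
... | small i = from-yes (F.all? {12} λ i → (1 ℕ.≤? toℕ i) →-dec (12000 * 12000 ℕ.≤? upper (toℕ i) * upper (toℕ i) * toℕ i)) i
... | large o = λ _ → ℕ.≤-trans (from-yes (12000 * 12000 ℕ.≤? 3465 * 3465 * 12)) (ℕ.*-monoʳ-≤ (3465 * 3465) (ℕ.m≤m+n 12 o))

lower-valid : ∀ k → lower k * lower k * k ≤ 12000 * 12000
lower-valid 0 = z≤n
lower-valid 1 = z≤n
lower-valid 2 = z≤n
lower-valid 3 = from-yes (6928 * 6928 * 3 ℕ.≤? 12000 * 12000)
lower-valid 4 = from-yes (6000 * 6000 * 4 ℕ.≤? 12000 * 12000)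
lower-valid 5 = from-yes (5366 * 5366 * 5 ℕ.≤? 12000 * 12000)
lower-valid (suc (suc (suc (suc (suc (suc k)))))) = z≤n

-- weight d is 1/4 + β (1/d - 1/2) in units of 1/12000, with 930/12000 ≥ β/2 in the
-- place of β/2 so that the edges {1,2} get no slack; from d = 6 on it is replaced by
-- its limit, and its value at 0 is arbitrary.  charge d e is the part of the slack of
-- an edge with end degrees d and e that is assigned to the end of degree d.

weight : ℕ → ℕ
weight 0 = 12000
weight 1 = 3930
weight 2 = 3000
weight 3 = 2690
weight 4 = 2535
weight 5 = 2442
weight _ = 2070

charge : ℕ → ℕ → ℕ
charge 0 _ = 0
charge 1 _ = 0
charge 2 _ = 0
charge 3 1 = 620
charge 3 2 = 323
charge 3 _ = 240
charge _ _ = 337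

EdgeBound : ℕ → ℕ → Set
EdgeBound a b = 3 ≤ a + b → upper (a + b) + (charge a b + charge b a) ≤ weight a + weight b

edgeBound? : ∀ a b → Dec (EdgeBound a b)
edgeBound? a b = (3 ℕ.≤? a + b) →-dec (upper (a + b) + (charge a b + charge b a) ℕ.≤? weight a + weight b)

-- This bound dictates the charges. The whole slack of an edge {1,3} is 3930 + 2690 - 6000 = 620 and
-- that of {2,3} is 3000 + 2690 - 5367 = 323; an edge {3,3} has slack 481, of which each end gets
-- 240. The tightest case for 337 is two ends of degree at least 6, with slack 2 · 2070 - 3465 =
-- 675.
edge-bound : ∀ a b → EdgeBound a b
edge-bound a b with small-or-large 12 a | small-or-large 12 b
... | small i | small j = from-yes (F.all? {12} λ i → F.all? {12} λ j → edgeBound? (toℕ i) (toℕ j)) i j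
... | small i | large o = from-yes (F.all? {12} λ i → edgeBound? (toℕ i) (12 + o)) i
... | large o | small j = from-yes (F.all? {12} λ j → edgeBound? (12 + o) (toℕ j)) j
... | large o | large q = from-yes (edgeBound? (12 + o) (12 + q))

-- This is d (1/4 + β (1/d - 1/2)) = d/4 + β - (β/2) d with the negative term moved to the left. It
-- is sharp for degrees 1 to 5. Summed over the vertices, the constant term contributes βn, which
-- reflects that the edge sum of 1/d_u + 1/d_v is n.
vertex-bound : ∀ d → d * weight d + 930 * d ≤ 3000 * d + 1860
vertex-bound 0 = z≤n
vertex-bound 1 = from-yes (4860 ℕ.≤? 4860)
vertex-bound 2 = from-yes (7860 ℕ.≤? 7860)
vertex-bound 3 = from-yes (10860 ℕ.≤? 10860)
vertex-bound 4 = from-yes (13860 ℕ.≤? 13860)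
vertex-bound 5 = from-yes (16860 ℕ.≤? 16860)
vertex-bound d@(suc (suc (suc (suc (suc (suc _)))))) = begin
  d * 2070 + 930 * d   ≡⟨ lemma d 2070 930 ⟩
  (2070 + 930) * d     ≤⟨ ℕ.m≤m+n (3000 * d) 1860 ⟩
  3000 * d + 1860      ∎
  where
  open ℕ.≤-Reasoning
  lemma : ∀ d x y → d * x + y * d ≡ (x + y) * d
  lemma d x y = trans (cong (_+ y * d) (ℕ.*-comm d x)) (sym (ℕ.*-distribʳ-+ d x y))

chargeAt : ∀ {n} → Graph n → Fin n → ℕ
chargeAt {n} G i = ∑[ j < n ] pick (adj G i j) (charge (deg G i) (deg G j))

pick-mono : ∀ b {x y} → (b ≡ true → x ≤ y) → pick b x ≤ pick b y
pick-mono true  le = le refl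
pick-mono false le = z≤n

χ-bound : ∀ {n} (G : Graph n) → (∀ i j → adj G i j ≡ true → 3 ≤ deg G i + deg G j) →
  SN.eval upper (χ G) + ∑[ i < n ] chargeAt G i + 930 * volume G ≤ 3000 * volume G + 1860 * n
χ-bound {n} G edge≥3 = begin
  SN.eval upper (χ G) + ∑[ i < n ] chargeAt G i + 930 * volume G
    ≤⟨ ℕ.+-monoˡ-≤ (930 * volume G) weights ⟩
  ∑[ i < n ] (deg G i * weight (deg G i)) + 930 * volume G
    ≡⟨ cong (∑[ i < n ] (deg G i * weight (deg G i)) +_) (*-distribˡ-sum 930 (deg G)) ⟩
  ∑[ i < n ] (deg G i * weight (deg G i)) + ∑[ i < n ] (930 * deg G i)
    ≡⟨ SN.∑-distrib-+ {n} _ _ ⟨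
  ∑[ i < n ] (deg G i * weight (deg G i) + 930 * deg G i)
    ≤⟨ ∑-mono (λ i → vertex-bound (deg G i)) ⟩
  ∑[ i < n ] (3000 * deg G i + 1860)
    ≡⟨ SN.∑-distrib-+ {n} _ _ ⟩
  ∑[ i < n ] (3000 * deg G i) + ∑[ i < n ] 1860
    ≡⟨ cong₂ _+_ (sym (*-distribˡ-sum 3000 (deg G))) (trans (SN.sum-replicate n) (trans (×≡* n 1860) (ℕ.*-comm n 1860))) ⟩
  3000 * volume G + 1860 * n ∎
  where
  open ℕ.≤-Reasoning
  d : Fin n → ℕ
  d = deg G
  below : Fin n → Fin n → Bool
  below i j = (toℕ i ℕ.<ᵇ toℕ j) ∧ adj G i j
  ends : Fin n → Fin n → ℕ
  ends i j = charge (d i) (d j) + charge (d j) (d i)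
  below⇒adj : ∀ i j → below i j ≡ true → adj G i j ≡ true
  below⇒adj i j e with toℕ i ℕ.<ᵇ toℕ j
  ... | true = e
  weights : SN.eval upper (χ G) + ∑[ i < n ] chargeAt G i ≤ ∑[ i < n ] (d i * weight (d i))
  weights = begin
    SN.eval upper (χ G) + ∑[ i < n ] chargeAt G i
      ≡⟨ cong₂ _+_ (SN.eval-χ upper G) (sym (SN.handshake G (λ i j → charge (d i) (d j)))) ⟩
    ∑[ i < n ] ∑[ j < n ] pick (below i j) (upper (d i + d j)) + ∑[ i < n ] ∑[ j < n ] pick (below i j) (ends i j)
      ≡⟨ SN.∑-distrib-+ {n} _ _ ⟨
    ∑[ i < n ] (∑[ j < n ] pick (below i j) (upper (d i + d j)) + ∑[ j < n ] pick (below i j) (ends i j))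
      ≡⟨ SN.sum-cong-≋ {n} (λ i → SN.∑-distrib-+ {n} _ _) ⟨
    ∑[ i < n ] ∑[ j < n ] (pick (below i j) (upper (d i + d j)) + pick (below i j) (ends i j))
      ≡⟨ SN.sum-cong-≋ {n} (λ i → SN.sum-cong-≋ {n} (λ j → SN.pick-+ (below i j) (upper (d i + d j)) (ends i j))) ⟨
    ∑[ i < n ] ∑[ j < n ] pick (below i j) (upper (d i + d j) + ends i j)
      ≤⟨ ∑-mono (λ i → ∑-mono (λ j → pick-mono (below i j) (λ e → edge-bound (d i) (d j) (edge≥3 i j (below⇒adj i j e))))) ⟩
    ∑[ i < n ] ∑[ j < n ] pick (below i j) (weight (d i) + weight (d j))
      ≡⟨ SN.handshake G (λ i _ → weight (d i)) ⟩
    ∑[ i < n ] ∑[ j < n ] pick (adj G i j) (weight (d i))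
      ≡⟨ SN.sum-cong-≋ {n} (λ i → trans (SN.∑-adj-const G i (weight (d i))) (×≡* (d i) (weight (d i)))) ⟩
    ∑[ i < n ] (d i * weight (d i)) ∎

-- By `χ-bound` each unit of the degree sum is worth 3000 - 930 = 2070, so a degree sum that is `t`
-- below 2n loses that much `t` times.
deficit : ∀ {n} (G : Graph n) → (∀ i j → adj G i j ≡ true → 3 ≤ deg G i + deg G j) →
  ∀ {t} → volume G + t ≡ 2 * n → ∀ {D} → D ≤ ∑[ i < n ] chargeAt G i + 2070 * t →
  SN.eval upper (χ G) + D ≤ halves n
deficit {n} G edge≥3 {t} v+t {D} D≤ = subst (SN.eval upper (χ G) + D ≤_) (sym (trans (halves-def n) (ℕ.*-comm n 6000)))
  (arith (SN.eval upper (χ G)) (∑[ i < n ] chargeAt G i) (volume G) t n D 930 2070 v+t D≤ (χ-bound G edge≥3))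
  where
  open ℕ-Solver
  open ℕ.≤-Reasoning
  -- Here `b` is 930 and `e` is 2070, so that 3000 = b + e, 1860 = 2b and 6000 = 2(b + e).
  arith : ∀ x c v t n D b e → v + t ≡ 2 * n → D ≤ c + e * t →
    x + c + b * v ≤ (b + e) * v + (2 * b) * n → x + D ≤ (2 * (b + e)) * n
  arith x c v t n D b e v+t D≤ le = ℕ.+-cancelʳ-≤ (b * (2 * n)) _ _ (begin
    x + D + b * (2 * n)                    ≡⟨ cong (λ z → x + D + b * z) v+t ⟨
    x + D + b * (v + t)                    ≤⟨ ℕ.+-monoˡ-≤ _ (ℕ.+-monoʳ-≤ x D≤) ⟩
    x + (c + e * t) + b * (v + t)          ≡⟨ solve 6 (λ x c v t b e → x :+ (c :+ e :* t) :+ b :* (v :+ t) := x :+ c :+ b :* v :+ (b :+ e) :* t) refl x c v t b e ⟩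
    x + c + b * v + (b + e) * t            ≤⟨ ℕ.+-monoˡ-≤ _ le ⟩
    (b + e) * v + (2 * b) * n + (b + e) * t ≡⟨ solve 5 (λ v t n b e → (b :+ e) :* v :+ (con 2 :* b) :* n :+ (b :+ e) :* t := (b :+ e) :* (v :+ t) :+ b :* (con 2 :* n)) refl v t n b e ⟩
    (b + e) * (v + t) + b * (2 * n)        ≡⟨ cong (λ z → (b + e) * z + b * (2 * n)) v+t ⟩
    (b + e) * (2 * n) + b * (2 * n)        ≡⟨ solve 3 (λ s n b → s :* (con 2 :* n) :+ b :* (con 2 :* n) := (con 2 :* s) :* n :+ b :* (con 2 :* n)) refl (b + e) n b ⟩
    (2 * (b + e)) * n + b * (2 * n)        ∎)

All-χ : ∀ {n} (G : Graph n) {P : ℕ × ℕ → Set} →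
  (∀ i j → adj G i j ≡ true → P (1 , deg G i + deg G j)) → All P (χ G)
All-χ G {P} edge = concat⁺ (map⁺ (tabulate⁺ λ i → concat⁺ (map⁺ (tabulate⁺ λ j → entry i j))))
  where
  entry : ∀ i j → All P (if (toℕ i ℕ.<ᵇ toℕ j) ∧ adj G i j then [ (1 , deg G i + deg G j) ] else [])
  entry i j with toℕ i ℕ.<ᵇ toℕ j | adj G i j | edge i j
  ... | true  | true  | e = e refl ∷ []
  ... | true  | false | _ = []
  ... | false | _     | _ = []

-- Two adjacent vertices of degree one would form a connected component.
edge≥3 : ∀ {ℓ} (G : Graph (suc ℓ)) → Connected G → 2 ≤ ℓ → ∀ i j → adj G i j ≡ true → 3 ≤ deg G i + deg G j
edge≥3 {ℓ} G conn 2≤ℓ i j ij with deg G i ℕ.≤? 1 | deg G j ℕ.≤? 1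
... | no i≰1  | _ = ℕ.+-mono-≤ (ℕ.≰⇒> i≰1) (length≤deg G j ([] ∷ []) (trans (Graph.sym G j i) ij ∷ []))
... | yes _   | no j≰1 = ℕ.+-mono-≤ (length≤deg G i ([] ∷ []) (ij ∷ [])) (ℕ.≰⇒> j≰1)
... | yes i≤1 | yes j≤1 = ⊥-elim (ℕ.<⇒≱ (s≤s 2≤ℓ) (begin
  suc ℓ                    ≡⟨ ℕ.*-identityʳ (suc ℓ) ⟨
  suc ℓ * 1                ≡⟨ ×≡* (suc ℓ) 1 ⟨
  suc ℓ SN.× 1             ≡⟨ SN.sum-replicate (suc ℓ) ⟨
  count {suc ℓ} (λ _ → true) ≤⟨ count≤length (λ _ → true) (i ∷ j ∷ []) (λ z _ → stay (here refl) (conn i z)) ⟩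
  2                        ∎))
  where
  open ℕ.≤-Reasoning
  stay : ∀ {u z} → u ∈ (i ∷ j ∷ []) → Reach G u z → z ∈ (i ∷ j ∷ [])
  stay u∈ here = u∈
  stay (here refl) (step d r) with neighbours-exhausted G i ([] ∷ []) (ij ∷ []) i≤1 d
  ... | here refl = stay (there (here refl)) r
  stay (there (here refl)) (step d r) with neighbours-exhausted G j ([] ∷ []) (trans (Graph.sym G j i) ij ∷ []) j≤1 d
  ... | here refl = stay (here refl) r

chargeAt≥ : ∀ {n} (G : Graph n) v c → (∀ j → adj G v j ≡ true → c ≤ charge (deg G v) (deg G j)) →
  deg G v * c ≤ chargeAt G v
chargeAt≥ {n} G v c le = begin
  deg G v * c                        ≡⟨ ×≡* (deg G v) c ⟨
  deg G v SN.× c                     ≡⟨ SN.∑-adj-const G v c ⟨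
  ∑[ j < n ] pick (adj G v j) c      ≤⟨ ∑-mono (λ j → pick-mono (adj G v j) (le j)) ⟩
  chargeAt G v                       ∎
  where open ℕ.≤-Reasoning

charge≥337 : ∀ {d} e → 4 ≤ d → 337 ≤ charge d e
charge≥337 e (s≤s (s≤s (s≤s (s≤s _)))) = ℕ.≤-refl

charge≥240 : ∀ {d} e → 3 ≤ d → 240 ≤ charge d e
charge≥240 {suc (suc (suc zero))} 0 _ = ℕ.≤-refl
charge≥240 {suc (suc (suc zero))} 1 _ = from-yes (240 ℕ.≤? 620)
charge≥240 {suc (suc (suc zero))} 2 _ = from-yes (240 ℕ.≤? 323)
charge≥240 {suc (suc (suc zero))} (suc (suc (suc e))) _ = ℕ.≤-refl
charge≥240 {suc (suc (suc (suc d)))} e _ = from-yes (240 ℕ.≤? 337)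
charge≥240 {suc zero} _ (s≤s ())
charge≥240 {suc (suc zero)} _ (s≤s (s≤s ()))

-- Large deficit or known shape

module Classification {ℓ} (G : Graph (suc ℓ)) (2≤ℓ : 2 ≤ ℓ) (uni : Unicyclic G) where
  private
    n : ℕ
    n = suc ℓ

    conn : Connected G
    conn = proj₁ uni

    volume≤ : volume G ≤ 2 * n
    volume≤ = unicyclic⇒volume≤ G uni

  HasDeficit : ℕ → Set
  HasDeficit D = SN.eval upper (χ G) + D ≤ halves n

  HasDeficit-weaken : ∀ {C D} → C ≤ D → HasDeficit D → HasDeficit C
  HasDeficit-weaken C≤D = ℕ.≤-trans (ℕ.+-monoʳ-≤ (SN.eval upper (χ G)) C≤D)

  private
    missing-edges : ∀ {D} → D ≤ ∑[ i < n ] chargeAt G i + 2070 * (2 * n ∸ volume G) → HasDeficit D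
    missing-edges = deficit G (edge≥3 G conn 2≤ℓ) (ℕ.m+[n∸m]≡n volume≤)

  charges : ∀ {D} → D ≤ ∑[ i < n ] chargeAt G i → HasDeficit D
  charges D≤ = missing-edges (ℕ.≤-trans D≤ (ℕ.m≤m+n (∑[ i < n ] chargeAt G i) (2070 * (2 * n ∸ volume G))))

  private
    two-branches : ∀ {v w} → v ≢ w → 3 ≤ deg G v → 3 ≤ deg G w → HasDeficit 1440
    two-branches {v} {w} v≢w 3≤v 3≤w = charges (begin
      720 + 720
        ≡⟨ cong₂ _+_ (SN.∑-pick-≟ v 720) (SN.∑-pick-≟ w 720) ⟨
      ∑[ i < n ] pick (does (i F.≟ v)) 720 + ∑[ i < n ] pick (does (i F.≟ w)) 720
        ≡⟨ SN.∑-distrib-+ {n} (λ i → pick (does (i F.≟ v)) 720) (λ i → pick (does (i F.≟ w)) 720) ⟨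
      ∑[ i < n ] (pick (does (i F.≟ v)) 720 + pick (does (i F.≟ w)) 720)
        ≤⟨ ∑-mono two ⟩
      ∑[ i < n ] chargeAt G i ∎)
      where
      open ℕ.≤-Reasoning
      720≤ : ∀ {i} → 3 ≤ deg G i → 720 ≤ chargeAt G i
      720≤ {i} 3≤ = ℕ.≤-trans (ℕ.*-monoˡ-≤ 240 3≤) (chargeAt≥ G i 240 λ j _ → charge≥240 (deg G j) 3≤)
      two : ∀ i → pick (does (i F.≟ v)) 720 + pick (does (i F.≟ w)) 720 ≤ chargeAt G i
      two i with i F.≟ v | i F.≟ w
      ... | yes refl | yes refl = ⊥-elim (v≢w refl)
      ... | yes refl | no  _    = 720≤ 3≤v
      ... | no  _    | yes refl = 720≤ 3≤w
      ... | no  _    | no  _    = z≤n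

    -- The degrees are bounded term by term by those of a lasso, while the total is at least as
    -- large; hence all bounds are equalities and `marked-lasso` applies.
    lasso : ∀ {v w} → 2 * n ≤ volume G →
      (∀ u → deg G u + pick (does (u F.≟ w)) 1 ≤ 2 + pick (does (u F.≟ v)) 1) → ∃ λ m → IsLasso m G
    lasso {v} {w} ≤volume le = let m , L , _ = marked-lasso G conn (∑-≤-tight le total) in m , L
      where
      open ℕ.≤-Reasoning
      total : ∑[ u < n ] (2 + pick (does (u F.≟ v)) 1) ≤ ∑[ u < n ] (deg G u + pick (does (u F.≟ w)) 1)
      total = begin
        ∑[ u < n ] (2 + pick (does (u F.≟ v)) 1)          ≡⟨ ∑-2+mark v ⟩
        2 * n + 1                                         ≤⟨ ℕ.+-monoˡ-≤ 1 ≤volume ⟩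
        volume G + 1                                      ≡⟨ ∑-deg+mark G w ⟨
        ∑[ u < n ] (deg G u + pick (does (u F.≟ w)) 1)    ∎

    -- A vertex of degree at most 1 other than `v` serves as the leaf. Without one, either `v` has
    -- degree at most 2 and carries both marks, which is the case of the cycle, or the degree sum
    -- would exceed 2n.
    one-branch : ∀ {v} → deg G v ≤ 3 → (∀ u → u ≢ v → deg G u ≤ 2) → 2 * n ≤ volume G → ∃ λ m → IsLasso m G
    one-branch {v} v≤3 others ≤volume with F.any? (λ w → ¬? (w F.≟ v) ×-dec (deg G w ℕ.≤? 1))
    ... | yes (w , w≢v , w≤1) = lasso ≤volume le
      where
      le : ∀ u → deg G u + pick (does (u F.≟ w)) 1 ≤ 2 + pick (does (u F.≟ v)) 1
      le u with u F.≟ w | u F.≟ v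
      ... | yes refl | yes refl = ⊥-elim (w≢v refl)
      ... | yes refl | no  _    = ℕ.+-monoˡ-≤ 1 w≤1
      ... | no  _    | yes refl = ℕ.≤-trans (ℕ.≤-reflexive (ℕ.+-identityʳ _)) v≤3
      ... | no  _    | no  u≢v  = ℕ.≤-trans (ℕ.≤-reflexive (ℕ.+-identityʳ _)) (others u u≢v)
    ... | no none with deg G v ℕ.≤? 2
    ...   | yes v≤2 = lasso {v} {v} ≤volume λ u → ℕ.+-monoˡ-≤ (pick (does (u F.≟ v)) 1) (≤2 u)
      where
      ≤2 : ∀ u → deg G u ≤ 2
      ≤2 u with u F.≟ v
      ... | yes refl = v≤2
      ... | no u≢v   = others u u≢v
    ...   | no  v≰2 = ⊥-elim (ℕ.<⇒≱ ℕ.≤-refl (begin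
      suc (2 * n)                                       ≡⟨ ℕ.+-comm 1 (2 * n) ⟩
      2 * n + 1                                         ≡⟨ ∑-2+mark v ⟨
      ∑[ u < n ] (2 + pick (does (u F.≟ v)) 1)          ≤⟨ ∑-mono ge ⟩
      volume G                                          ≤⟨ volume≤ ⟩
      2 * n                                             ∎))
      where
      open ℕ.≤-Reasoning
      ge : ∀ u → 2 + pick (does (u F.≟ v)) 1 ≤ deg G u
      ge u with u F.≟ v
      ... | yes refl = ℕ.≰⇒> v≰2
      ... | no  u≢v  = ℕ.≰⇒> λ u≤1 → none (u , u≢v , u≤1)

  -- The number 1270 is what a comparison with `U43` requires: its lower bound is 2 · 6000 + 2 ·
  -- 5366 = 22732, and 24000 + 2 - 22732 = 1270. The comparison for n ≥ 5 requires less.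
  classify : HasDeficit 1270 ⊎ ∃ λ m → IsLasso m G
  classify with 2 * n ℕ.≤? volume G
  ... | no  ≰volume = inj₁ (missing-edges (begin
    1270                              ≤⟨ from-yes (1270 ℕ.≤? 2070 * 1) ⟩
    2070 * 1                          ≤⟨ ℕ.*-monoʳ-≤ 2070 (ℕ.m<n⇒0<n∸m (ℕ.≰⇒> ≰volume)) ⟩
    2070 * (2 * n ∸ volume G)         ≤⟨ ℕ.m≤n+m (2070 * (2 * n ∸ volume G)) (∑[ i < n ] chargeAt G i) ⟩
    ∑[ i < n ] chargeAt G i + 2070 * (2 * n ∸ volume G) ∎))
    where open ℕ.≤-Reasoning
  ... | yes ≤volume with F.any? (λ v → 4 ℕ.≤? deg G v)
  ...   | yes (v , 4≤v) = inj₁ (charges (begin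
    1270                      ≤⟨ from-yes (1270 ℕ.≤? 4 * 337) ⟩
    4 * 337                   ≤⟨ ℕ.*-monoˡ-≤ 337 4≤v ⟩
    deg G v * 337             ≤⟨ chargeAt≥ G v 337 (λ j _ → charge≥337 (deg G j) 4≤v) ⟩
    chargeAt G v              ≤⟨ term≤∑ (chargeAt G) v ⟩
    ∑[ i < n ] chargeAt G i   ∎))
    where open ℕ.≤-Reasoning
  ...   | no  none≥4 with F.any? (λ v → 3 ℕ.≤? deg G v)
  ...     | no none≥3 = inj₂ (one-branch {zero} (ℕ.m≤n⇒m≤1+n (≤2 zero)) (λ u _ → ≤2 u) ≤volume)
    where
    ≤2 : ∀ u → deg G u ≤ 2
    ≤2 u = ℕ.≤-pred (ℕ.≰⇒> λ 3≤ → none≥3 (u , 3≤))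
  ...     | yes (v , 3≤v) with F.any? (λ w → ¬? (w F.≟ v) ×-dec (3 ℕ.≤? deg G w))
  ...       | yes (w , w≢v , 3≤w) = inj₁ (HasDeficit-weaken (from-yes (1270 ℕ.≤? 1440)) (two-branches w≢v 3≤w 3≤v))
  ...       | no  none = inj₂ (one-branch {v} (ℕ.≤-pred (ℕ.≰⇒> λ 4≤ → none≥4 (v , 4≤)))
    (λ u u≢v → ℕ.≤-pred (ℕ.≰⇒> λ 3≤ → none (u , u≢v , 3≤))) ≤volume)

  module _ {m} (L : IsLasso (suc m) G) where
    open IsLasso L

    private
      v = p (suc m)

      deg-v : deg G v ≡ 3
      deg-v = lasso-deg-branch L

      -- The bonus 297 = 620 - 323 is the extra slack of an edge from the branch vertex to a leaf.
      neighbour-charge : ∀ j → adj G v j ≡ true → 323 + pick (does (j F.≟ p 0)) 297 ≤ charge (deg G v) (deg G j)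
      neighbour-charge j vj rewrite deg-v with lasso-degrees L j
      ... | leaf refl d   rewrite d | pick-≟-diag (p 0) = ℕ.≤-refl
      ... | branch refl _ = ⊥-elim (adj-≢ G vj refl)
      ... | inner j≢ _ d  rewrite d | dec-false (j F.≟ p 0) j≢ = ℕ.≤-refl

    lasso-deficit : HasDeficit 969
    lasso-deficit = charges (begin
      3 * 323                  ≡⟨ cong (_* 323) {deg G v} {3} deg-v ⟨
      deg G v * 323            ≤⟨ chargeAt≥ G v 323 (λ j vj → ℕ.≤-trans (ℕ.m≤m+n 323 _) (neighbour-charge j vj)) ⟩
      chargeAt G v             ≤⟨ term≤∑ (chargeAt G) v ⟩
      ∑[ i < n ] chargeAt G i  ∎)
      where open ℕ.≤-Reasoning

    -- The leaf is now adjacent to the branch vertex and brings in the bonus. The total 1266 exceeds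
    -- 976 but not 1270, as it must, since `U43` is itself a graph of this kind.
    short-tail-deficit : m ≡ 0 → HasDeficit 976
    short-tail-deficit refl = charges (begin
      976                                                            ≤⟨ from-yes (976 ℕ.≤? 3 * 323 + 297) ⟩
      3 * 323 + 297                                                  ≡⟨ cong (λ d → d * 323 + 297) deg-v ⟨
      deg G v * 323 + 297                                            ≡⟨ cong₂ _+_ (trans (SN.∑-adj-const G v 323) (×≡* (deg G v) 323)) (SN.∑-pick-≟ (p 0) 297) ⟨
      ∑[ j < n ] pick (adj G v j) 323 + ∑[ j < n ] pick (does (j F.≟ p 0)) 297
        ≡⟨ SN.∑-distrib-+ {n} (λ j → pick (adj G v j) 323) (λ j → pick (does (j F.≟ p 0)) 297) ⟨
      ∑[ j < n ] (pick (adj G v j) 323 + pick (does (j F.≟ p 0)) 297)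
        ≤⟨ ∑-mono le ⟩
      chargeAt G v                                                   ≤⟨ term≤∑ (chargeAt G) v ⟩
      ∑[ i < n ] chargeAt G i                                        ∎)
      where
      open ℕ.≤-Reasoning
      le : ∀ j → pick (adj G v j) 323 + pick (does (j F.≟ p 0)) 297 ≤ pick (adj G v j) (charge (deg G v) (deg G j))
      le j with adj G v j in vj
      ... | true  = neighbour-charge j vj
      ... | false with j F.≟ p 0
      ...   | no  _    = z≤n
      ...   | yes refl with trans (sym vj) (link⇒adj m≤ℓ z≤n down)
      ...     | ()

-- Exact values and explicit comparisons

eval-2-regular-ℕ : ∀ {n} (G : Graph n) → (∀ i → deg G i ≡ 2) → SN.eval lower (χ G) ≡ halves n
eval-2-regular-ℕ {n} G 2-reg = trans (SN.eval-2-regular G lower 3000 refl 2-reg) (trans (×≡* n 6000) (sym (halves-def n)))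

χ-2-regular : ∀ {n} (G : Graph n) → (∀ i → deg G i ≡ 2) → χ G ≈ᵣ ((n , 4) ∷ [])
χ-2-regular {n} G 2-reg = ≈ᵣ-intro (χ G) ((n , 4) ∷ []) λ u → begin
  evalℚ u (χ G)           ≡⟨ eval≡evalℚ u (χ G) ⟨
  SQ.eval u (χ G)         ≡⟨ SQ.eval-2-regular G u (½ ⊗ u 4) (½+½ (u 4)) 2-reg ⟩
  n SQ.× u 4              ≡⟨ ℚ.+-identityʳ _ ⟨
  SQ.eval u ((n , 4) ∷ []) ≡⟨ eval≡evalℚ u ((n , 4) ∷ []) ⟩
  evalℚ u ((n , 4) ∷ [])  ∎
  where
  open ≡-Reasoning
  open ℚ-Solver
  ½+½ : ∀ x → ½ ⊗ x ⊕ ½ ⊗ x ≡ x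
  ½+½ = solve 1 (λ x → con ½ :* x :+ con ½ :* x := x) refl

second : ℕ → SqExpr
second n = (n ∸ 4 , 4) ∷ (1 , 3) ∷ (3 , 5) ∷ []

-- Each vertex takes the share σ of its degree from every incident edge, where
-- u (a + b) = σ a + σ b for the end degrees {1,2}, {2,2} and {2,3}.
χ-lasso : ∀ {ℓ m} (G : Graph (suc ℓ)) → IsLasso (suc (suc m)) G → χ G ≈ᵣ second (suc ℓ)
χ-lasso {ℓ} {m} G L = ≈ᵣ-intro (χ G) (second (suc ℓ)) λ u → trans (sym (eval≡evalℚ u (χ G))) (value u)
  where
  open IsLasso L
  open ℚ-Solver

  3≤ℓ : 3 ≤ ℓ
  3≤ℓ = ℕ.≤-trans (s≤s (s≤s (ℕ.≤-trans (s≤s z≤n) (ℕ.m≤n+m 2 m)))) gap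

  b : Fin (suc ℓ)
  b = p (suc (suc m))

  -- An edge {1,3} has the same symbol `u 4` as {2,2}, and the shares `σ` do not fit it; a tail of
  -- length at least two excludes it.
  leaf-branch : adj G (p 0) b ≢ true
  leaf-branch e = no-link (adj⇒link z≤n m≤ℓ e) gap
    where
    no-link : ∀ {ℓ} → Link (suc (suc m)) ℓ 0 (suc (suc m)) → suc (suc m) + 2 ≤ ℓ → ⊥
    no-link reopen ()

  module _ (u : ℕ → ℚ) where
    σ : ℕ → ℚ
    σ 1 = u 3 ⊖ ½ ⊗ u 4
    σ 3 = u 5 ⊖ ½ ⊗ u 4
    σ _ = ½ ⊗ u 4

    22-edge : u 4 ≡ ½ ⊗ u 4 ⊕ ½ ⊗ u 4
    22-edge = solve 1 (λ x → x := con ½ :* x :+ con ½ :* x) refl (u 4)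

    2-edge : ∀ x y → x ≡ y ⊕ (x ⊖ y)
    2-edge = solve 2 (λ x y → x := y :+ (x :+ (:- y))) refl

    edge : ∀ i j → adj G i j ≡ true → u (deg G i + deg G j) ≡ σ (deg G i) ⊕ σ (deg G j)
    edge i j ij with lasso-degrees L i | lasso-degrees L j
    ... | leaf refl _   | leaf refl _   = ⊥-elim (adj-≢ G ij refl)
    ... | leaf refl _   | branch refl _ = ⊥-elim (leaf-branch ij)
    ... | branch refl _ | leaf refl _   = ⊥-elim (leaf-branch (trans (Graph.sym G (p 0) b) ij))
    ... | branch refl _ | branch refl _ = ⊥-elim (adj-≢ G ij refl)
    ... | leaf _ d    | inner _ _ e rewrite d | e = trans (2-edge (u 3) (½ ⊗ u 4)) (ℚ.+-comm (½ ⊗ u 4) _)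
    ... | branch _ d  | inner _ _ e rewrite d | e = trans (2-edge (u 5) (½ ⊗ u 4)) (ℚ.+-comm (½ ⊗ u 4) _)
    ... | inner _ _ d | leaf _ e    rewrite d | e = 2-edge (u 3) (½ ⊗ u 4)
    ... | inner _ _ d | branch _ e  rewrite d | e = 2-edge (u 5) (½ ⊗ u 4)
    ... | inner _ _ d | inner _ _ e rewrite d | e = 22-edge

    -- Every vertex contributes `u 4` up to these two corrections, which add up to `u 3` plus three
    -- times `u 5` minus four times `u 4`. This is the origin of n - 4.
    leaf-excess branch-excess : ℚ
    leaf-excess   = 1 SQ.× σ 1 ⊖ u 4
    branch-excess = 3 SQ.× σ 3 ⊖ u 4

    at-leaf at-branch excess : Fin (suc ℓ) → ℚ
    at-leaf i   = SQ.pick (does (i F.≟ p 0)) leaf-excess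
    at-branch i = SQ.pick (does (i F.≟ b)) branch-excess
    excess i    = at-leaf i ⊕ at-branch i

    vertex : ∀ i → deg G i SQ.× σ (deg G i) ≡ u 4 ⊕ excess i
    vertex i with lasso-degrees L i
    ... | leaf refl d rewrite d | pick-≟-diag (p 0) | dec-false (p 0 F.≟ b) (lasso-ends-distinct L) =
      trans (2-edge (1 SQ.× σ 1) (u 4)) (cong (u 4 ⊕_) (sym (ℚ.+-identityʳ leaf-excess)))
    ... | branch refl d rewrite d | pick-≟-diag b | dec-false (b F.≟ p 0) (lasso-ends-distinct L ∘ sym) =
      trans (2-edge (3 SQ.× σ 3) (u 4)) (cong (u 4 ⊕_) (sym (ℚ.+-identityˡ branch-excess)))
    ... | inner e f d rewrite d | dec-false (i F.≟ p 0) e | dec-false (i F.≟ b) f =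
      trans (cong (½ ⊗ u 4 ⊕_) (ℚ.+-identityʳ _)) (trans (sym 22-edge) (sym (ℚ.+-identityʳ (u 4))))

    split : ∀ ℓ → 3 ≤ ℓ → suc ℓ SQ.× u 4 ≡ u 4 ⊕ (u 4 ⊕ (u 4 ⊕ (u 4 ⊕ (suc ℓ ∸ 4) SQ.× u 4)))
    split 1 (s≤s ())
    split 2 (s≤s (s≤s ()))
    split (suc (suc (suc ℓ))) _ = refl

    value : SQ.eval u (χ G) ≡ evalℚ u (second (suc ℓ))
    value = begin
      SQ.eval u (χ G)
        ≡⟨ SQ.∑-charges G u (σ ∘ deg G) edge ⟩
      SQ.sum (λ i → deg G i SQ.× σ (deg G i))
        ≡⟨ SQ.sum-cong-≋ {suc ℓ} vertex ⟩
      SQ.sum (λ i → u 4 ⊕ excess i)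
        ≡⟨ trans (SQ.∑-distrib-+ {suc ℓ} (λ _ → u 4) excess) (cong₂ _⊕_ (SQ.sum-replicate (suc ℓ) {u 4}) (trans (SQ.∑-distrib-+ {suc ℓ} at-leaf at-branch)
             (cong₂ _⊕_ (SQ.∑-pick-≟ (p 0) leaf-excess) (SQ.∑-pick-≟ b branch-excess)))) ⟩
      (suc ℓ) SQ.× u 4 ⊕ (leaf-excess ⊕ branch-excess)
        ≡⟨ cong (_⊕ (leaf-excess ⊕ branch-excess)) (split ℓ 3≤ℓ) ⟩
      (u 4 ⊕ (u 4 ⊕ (u 4 ⊕ (u 4 ⊕ (suc ℓ ∸ 4) SQ.× u 4)))) ⊕ (leaf-excess ⊕ branch-excess)
        ≡⟨ solve 4 (λ x y z t → (x :+ (x :+ (x :+ (x :+ t)))) :+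
             (((y :+ (:- (con ½ :* x))) :+ con 0ℚ :+ (:- x)) :+
              ((z :+ (:- (con ½ :* x))) :+ ((z :+ (:- (con ½ :* x))) :+ ((z :+ (:- (con ½ :* x))) :+ con 0ℚ)) :+ (:- x)))
             := t :+ ((y :+ con 0ℚ) :+ ((z :+ (z :+ (z :+ con 0ℚ))) :+ con 0ℚ))) refl (u 4) (u 3) (u 5) ((suc ℓ ∸ 4) SQ.× u 4) ⟩
      SQ.eval u (second (suc ℓ))
        ≡⟨ eval≡evalℚ u (second (suc ℓ)) ⟩
      evalℚ u (second (suc ℓ)) ∎
      where open ≡-Reasoning

upper-valid-χ : ∀ {ℓ} (G : Graph (suc ℓ)) → Connected G → 2 ≤ ℓ →
  All {A = ℕ × ℕ} (λ ck → 12000 * 12000 ≤ upper (proj₂ ck) * upper (proj₂ ck) * proj₂ ck) (χ G)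
upper-valid-χ G conn 2≤ℓ = All-χ G λ i j ij →
  upper-valid (deg G i + deg G j) (ℕ.≤-trans (s≤s z≤n) (edge≥3 G conn 2≤ℓ i j ij))

lower-valid-all : ∀ y → All {A = ℕ × ℕ} (λ ck → lower (proj₂ ck) * lower (proj₂ ck) * proj₂ ck ≤ 12000 * 12000) y
lower-valid-all y = All.universal (λ ck → lower-valid (proj₂ ck)) y

lollipop-is-lasso : ∀ {ℓ} m → m + 2 ≤ ℓ → IsLasso m (lollipop (suc ℓ) (suc ℓ ∸ m))
lollipop-is-lasso {ℓ} m gap = subst (λ z → IsLasso z (lollipop (suc ℓ) (suc ℓ ∸ m))) (ℕ.m∸[m∸n]≡n m≤n)
  (lollipop-lasso (ℕ.m+n≤o⇒m≤o∸n 3 (ℕ.≤-trans (ℕ.≤-reflexive (trans (ℕ.+-comm 3 m) (ℕ.+-suc m 2))) (s≤s gap))) (ℕ.m∸n≤m (suc ℓ) m))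
  where
  m≤n : m ≤ suc ℓ
  m≤n = ℕ.≤-trans (ℕ.m≤m+n m 2) (ℕ.m≤n⇒m≤1+n gap)

Cyc-lasso : ∀ {ℓ} → 2 ≤ ℓ → IsLasso 0 (Cyc (suc ℓ))
Cyc-lasso = lollipop-is-lasso 0

Cyc-2-regular : ∀ {ℓ} → 2 ≤ ℓ → ∀ i → deg (Cyc (suc ℓ)) i ≡ 2
Cyc-2-regular {ℓ} 2≤ℓ i = ℕ.+-cancelʳ-≡ (pick (does (i F.≟ IsLasso.p (Cyc-lasso 2≤ℓ) 0)) 1) (deg (Cyc (suc ℓ)) i) 2 (IsLasso.deg-lasso (Cyc-lasso 2≤ℓ) i)

U43-lasso : IsLasso 1 U43
U43-lasso = lollipop-is-lasso 1 ℕ.≤-refl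

below-Cyc : ∀ ℓ x → 2 ≤ ℓ → All {A = ℕ × ℕ} (λ ck → 12000 * 12000 ≤ upper (proj₂ ck) * upper (proj₂ ck) * proj₂ ck) x →
  2 + SN.eval upper x ≤ halves (suc ℓ) → x <ᵣ χ (Cyc (suc ℓ))
below-Cyc ℓ x 2≤ℓ ups lt = <ᵣ-intro 12000 upper lower x (χ (Cyc (suc ℓ))) ups (lower-valid-all (χ (Cyc (suc ℓ))))
  (subst (2 + SN.eval upper x ≤_) (sym (eval-2-regular-ℕ (Cyc (suc ℓ)) (Cyc-2-regular 2≤ℓ))) lt)

eval-second : ∀ u n → u 4 ≡ 6000 → SN.eval u (second n) ≡ halves (n ∸ 4) + (1 SN.× u 3 + (3 SN.× u 5 + 0))
eval-second u n e = cong (_+ (1 SN.× u 3 + (3 SN.× u 5 + 0)))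
  (trans (cong ((n ∸ 4) SN.×_) e) (trans (×≡* (n ∸ 4) 6000) (sym (halves-def (n ∸ 4)))))

-- 24000 + 2 = c + b: a deficit of b from n/2 leaves (n - 4)/2 + c with the margin of
-- 2 units that <ᵣ-intro asks for.
from-deficit : ∀ x n {b c} → 4 ≤ n → 4 * 6000 + 2 ≡ c + b → x + b ≤ halves n → 2 + x ≤ halves (n ∸ 4) + c
from-deficit x n {b} {c} 4≤n eq le with n ∸ 4 | ℕ.m+[n∸m]≡n 4≤n
... | k | refl rewrite halves-def k | halves-def (4 + k) = general 6000 eq le
  where
  open ℕ-Solver
  open ℕ.≤-Reasoning
  general : ∀ s → 4 * s + 2 ≡ c + b → x + b ≤ (4 + k) * s → 2 + x ≤ k * s + c
  general s eq le = ℕ.+-cancelʳ-≤ b (2 + x) (k * s + c) (begin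
    2 + x + b              ≤⟨ ℕ.+-monoʳ-≤ 2 le ⟩
    2 + (4 + k) * s        ≡⟨ solve 2 (λ s k → con 2 :+ (con 4 :+ k) :* s := k :* s :+ (con 4 :* s :+ con 2)) refl s k ⟩
    k * s + (4 * s + 2)    ≡⟨ cong (k * s +_) eq ⟩
    k * s + (c + b)        ≡⟨ ℕ.+-assoc (k * s) c b ⟨
    k * s + c + b          ∎)

second<halves : ∀ n → 4 ≤ n → 2 + SN.eval upper (second n) ≤ halves n
second<halves n 4≤n = subst (λ z → 2 + z ≤ halves n) (sym (eval-second upper n refl)) arith
  where
  open ℕ-Solver
  open ℕ.≤-Reasoning
  general : ∀ k s c → 2 + c ≤ 4 * s → 2 + (k * s + c) ≤ (4 + k) * s
  general k s c le = begin
    2 + (k * s + c)   ≡⟨ solve 3 (λ k s c → con 2 :+ (k :* s :+ c) := k :* s :+ (con 2 :+ c)) refl k s c ⟩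
    k * s + (2 + c)   ≤⟨ ℕ.+-monoʳ-≤ (k * s) le ⟩
    k * s + 4 * s     ≡⟨ solve 2 (λ k s → k :* s :+ con 4 :* s := (con 4 :+ k) :* s) refl k s ⟩
    (4 + k) * s       ∎
  -- 23030 = 6929 + 3 · 5367 is the rounded upper bound of 1/√3 + 3/√5.
  arith : 2 + (halves (n ∸ 4) + 23030) ≤ halves n
  arith with n ∸ 4 | ℕ.m+[n∸m]≡n 4≤n
  ... | k | refl rewrite halves-def k | halves-def (4 + k) = general k 6000 23030 (from-yes (2 + 23030 ℕ.≤? 4 * 6000))

second-below-Cyc : ∀ ℓ → 3 ≤ ℓ → second (suc ℓ) <ᵣ χ (Cyc (suc ℓ))
second-below-Cyc ℓ 3≤ℓ = below-Cyc ℓ (second (suc ℓ)) (ℕ.<⇒≤ 3≤ℓ)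
  (upper-valid 4 (s≤s z≤n) ∷ upper-valid 3 (s≤s z≤n) ∷ upper-valid 5 (s≤s z≤n) ∷ []) (second<halves (suc ℓ) (s≤s 3≤ℓ))

χ-U43 : χ U43 ≡ (1 , 5) ∷ (1 , 5) ∷ (1 , 4) ∷ (1 , 4) ∷ []
χ-U43 = refl

U43-value : χ U43 ≈ᵣ ((2 , 4) ∷ (2 , 5) ∷ [])
U43-value = ≈ᵣ-intro (χ U43) ((2 , 4) ∷ (2 , 5) ∷ []) λ u → trans (sym (eval≡evalℚ u (χ U43)))
  (trans (cong (SQ.eval u) χ-U43) (trans (regroup (u 4) (u 5)) (eval≡evalℚ u ((2 , 4) ∷ (2 , 5) ∷ []))))
  where
  open ℚ-Solver
  regroup : ∀ x y → (y ⊕ 0ℚ) ⊕ ((y ⊕ 0ℚ) ⊕ ((x ⊕ 0ℚ) ⊕ ((x ⊕ 0ℚ) ⊕ 0ℚ)))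
    ≡ (x ⊕ (x ⊕ 0ℚ)) ⊕ ((y ⊕ (y ⊕ 0ℚ)) ⊕ 0ℚ)
  regroup = solve 2 (λ x y → (y :+ con 0ℚ) :+ ((y :+ con 0ℚ) :+ ((x :+ con 0ℚ) :+ ((x :+ con 0ℚ) :+ con 0ℚ)))
    := (x :+ (x :+ con 0ℚ)) :+ ((y :+ (y :+ con 0ℚ)) :+ con 0ℚ)) refl

-- Comparing an arbitrary unicyclic graph with the extremal ones

module Comparison {ℓ} (3≤ℓ : 3 ≤ ℓ) (G : Graph (suc ℓ)) (uni : Unicyclic G) where
  private
    2≤ℓ : 2 ≤ ℓ
    2≤ℓ = ℕ.<⇒≤ 3≤ℓ

  open Classification G 2≤ℓ uni public

  deficit⇒below-Cyc : HasDeficit 969 → χ G <ᵣ χ (Cyc (suc ℓ))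
  deficit⇒below-Cyc d = below-Cyc ℓ (χ G) 2≤ℓ (upper-valid-χ G (proj₁ uni) 2≤ℓ)
    (subst (_≤ halves (suc ℓ)) (ℕ.+-comm (SN.eval upper (χ G)) 2) (HasDeficit-weaken (from-yes (2 ℕ.≤? 969)) d))

  -- The lower bound of 1/√3 + 3/√5 is 6928 + 3 · 5366 = 23026, and 24000 + 2 - 23026 = 976. The
  -- deficit 969 of a long tail falls short of this, in accordance with the equality that holds
  -- there.
  deficit⇒below-second : HasDeficit 976 → χ G <ᵣ second (suc ℓ)
  deficit⇒below-second d = <ᵣ-intro 12000 upper lower (χ G) (second (suc ℓ))
    (upper-valid-χ G (proj₁ uni) 2≤ℓ) (lower-valid-all (second (suc ℓ)))
    (subst (2 + SN.eval upper (χ G) ≤_) (sym (eval-second lower (suc ℓ) refl))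
      (from-deficit (SN.eval upper (χ G)) (suc ℓ) {976} {23026} (s≤s 3≤ℓ) refl d))

  lasso⇒Iso : ∀ {m} k → suc ℓ ∸ m ≡ k → IsLasso m G → Iso G (lollipop (suc ℓ) k)
  lasso⇒Iso {m} k refl L = lasso-iso L (lollipop-is-lasso m (IsLasso.gap L))

  below-Cyc-unless-Iso : ¬ Iso G (Cyc (suc ℓ)) → χ G <ᵣ χ (Cyc (suc ℓ))
  below-Cyc-unless-Iso ¬cyc with classify
  ... | inj₁ d           = deficit⇒below-Cyc (HasDeficit-weaken (from-yes (969 ℕ.≤? 1270)) d)
  ... | inj₂ (zero  , L) = ⊥-elim (¬cyc (lasso⇒Iso (suc ℓ) refl L))
  ... | inj₂ (suc m , L) = deficit⇒below-Cyc (lasso-deficit L)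

  long-tail⇒CycleWithPath : ∀ {m} → 2 ≤ m → IsLasso m G → CycleWithPath G
  long-tail⇒CycleWithPath {m} 2≤m L = suc ℓ ∸ m , 3≤k , k+2≤n , lasso⇒Iso (suc ℓ ∸ m) refl L
    where
    m+3≤n : m + 3 ≤ suc ℓ
    m+3≤n = ℕ.≤-trans (ℕ.≤-reflexive (ℕ.+-suc m 2)) (s≤s (IsLasso.gap L))
    3≤k : 3 ≤ suc ℓ ∸ m
    3≤k = ℕ.m+n≤o⇒m≤o∸n 3 (subst (_≤ suc ℓ) (ℕ.+-comm m 3) m+3≤n)
    k+2≤n : suc ℓ ∸ m + 2 ≤ suc ℓ
    k+2≤n = ℕ.≤-trans (ℕ.+-monoʳ-≤ (suc ℓ ∸ m) 2≤m)
      (ℕ.≤-reflexive (ℕ.m∸n+n≡m (ℕ.≤-trans (ℕ.m≤m+n m 3) m+3≤n)))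

  below-second-unless : ¬ Iso G (Cyc (suc ℓ)) → ¬ CycleWithPath G → χ G <ᵣ second (suc ℓ)
  below-second-unless ¬cyc ¬cwp with classify
  ... | inj₁ d                 = deficit⇒below-second (HasDeficit-weaken (from-yes (976 ℕ.≤? 1270)) d)
  ... | inj₂ (zero        , L) = ⊥-elim (¬cyc (lasso⇒Iso (suc ℓ) refl L))
  ... | inj₂ (suc zero    , L) = deficit⇒below-second (short-tail-deficit L refl)
  ... | inj₂ (suc (suc m) , L) = ⊥-elim (¬cwp (long-tail⇒CycleWithPath (s≤s (s≤s z≤n)) L))

CycleWithPath⇒second : ∀ {ℓ} (G : Graph (suc ℓ)) → CycleWithPath G → χ G ≈ᵣ second (suc ℓ)
CycleWithPath⇒second {ℓ} G (k , 3≤k , k+2≤n , iso) =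
  χ-lasso G (subst (λ m → IsLasso m G) (proj₂ long) (lasso-transport iso (lollipop-lasso 3≤k (ℕ.≤-trans (ℕ.m≤m+n k 2) k+2≤n))))
  where
  long : ∃ λ m → suc ℓ ∸ k ≡ suc (suc m)
  long with suc ℓ ∸ k | ℕ.m+n≤o⇒m≤o∸n 2 (subst (_≤ suc ℓ) (ℕ.+-comm k 2) k+2≤n)
  ... | suc (suc m) | _ = m , refl
  ... | suc zero    | s≤s ()

-- On four vertices a loop leaves room for a tail of length at most one, so the lassos are just the
-- cycle and `U43`; every other graph has the full deficit.
below-U43 : (G : Graph 4) → Unicyclic G → ¬ Iso G (Cyc 4) → ¬ Iso G U43 → χ G <ᵣ χ U43
below-U43 G uni ¬cyc ¬u43 with Comparison.classify {3} ℕ.≤-refl G uni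
... | inj₁ d              = <ᵣ-intro 12000 upper lower (χ G) (χ U43)
  (upper-valid-χ G (proj₁ uni) (s≤s (s≤s z≤n))) (lower-valid-all (χ U43))
  (subst (2 + SN.eval upper (χ G) ≤_) (trans (cong (_+ 22732) (halves-def 0)) (cong (SN.eval lower) (sym χ-U43)))
    (from-deficit (SN.eval upper (χ G)) 4 {1270} {22732} ℕ.≤-refl refl d))
... | inj₂ (zero     , L) = ⊥-elim (¬cyc (Comparison.lasso⇒Iso {3} ℕ.≤-refl G uni 4 refl L))
... | inj₂ (suc zero , L) = ⊥-elim (¬u43 (Comparison.lasso⇒Iso {3} ℕ.≤-refl G uni 3 refl L))
... | inj₂ (suc (suc m) , L) with subst (_≤ 3) (ℕ.+-comm (suc (suc m)) 2) (IsLasso.gap L)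
...   | s≤s (s≤s (s≤s ()))

theorem3 : ((n : ℕ) → 4 ≤ n →
    (Unicyclic (Cyc n)
    × χ (Cyc n) ≈ᵣ ((n , 4) ∷ [])
    × (∀ (G : Graph n) → Unicyclic G → ¬ Iso G (Cyc n) → χ G <ᵣ χ (Cyc n)))
    × (5 ≤ n →
    (∀ k → 3 ≤ k → k + 2 ≤ n → Unicyclic (lollipop n k))
    × ((((n ∸ 4) , 4) ∷ (1 , 3) ∷ (3 , 5) ∷ []) <ᵣ χ (Cyc n))
    × (∀ (G : Graph n) → Unicyclic G → ¬ Iso G (Cyc n) →
    (CycleWithPath G → χ G ≈ᵣ (((n ∸ 4) , 4) ∷ (1 , 3) ∷ (3 , 5) ∷ []))
    × (¬ CycleWithPath G → χ G <ᵣ (((n ∸ 4) , 4) ∷ (1 , 3) ∷ (3 , 5) ∷ [])))))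
    × (Unicyclic U43
    × χ U43 ≈ᵣ ((2 , 4) ∷ (2 , 5) ∷ [])
    × χ U43 <ᵣ χ (Cyc 4)
    × (∀ (G : Graph 4) → Unicyclic G → ¬ Iso G (Cyc 4) → ¬ Iso G U43 → χ G <ᵣ χ U43))
theorem3 = (λ { (suc ℓ) (s≤s 3≤ℓ) →
    (lasso-unicyclic (Cyc (suc ℓ)) (Cyc-lasso (ℕ.<⇒≤ 3≤ℓ)) ,
     χ-2-regular (Cyc (suc ℓ)) (Cyc-2-regular (ℕ.<⇒≤ 3≤ℓ)) ,
     Comparison.below-Cyc-unless-Iso 3≤ℓ) ,
    λ _ →
    (λ k 3≤k k+2≤n → lasso-unicyclic (lollipop (suc ℓ) k) (lollipop-lasso 3≤k (ℕ.≤-trans (ℕ.m≤m+n k 2) k+2≤n))) ,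
    second-below-Cyc ℓ 3≤ℓ ,
    λ G uni ¬cyc → CycleWithPath⇒second G , Comparison.below-second-unless 3≤ℓ G uni ¬cyc }) ,
  U43-unicyclic , U43-value ,
  Comparison.deficit⇒below-Cyc ℕ.≤-refl U43 U43-unicyclic (Comparison.lasso-deficit ℕ.≤-refl U43 U43-unicyclic U43-lasso) ,
  below-U43
  where
  U43-unicyclic : Unicyclic U43
  U43-unicyclic = lasso-unicyclic U43 U43-lasso
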